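{- $\mathbf{PMA}\subseteq\mathbf{U\Sigma_2^P}$.
   Context: Decision problems are identified with languages over $\Sigma=\{0,1\}$ under a standard encoding; $A\leq_P B$ means that $A$ is many-one reducible to $B$ in polynomial time. $\Vert$ (or juxtaposition) denotes concatenation of bit strings; bit strings are compared with integers by reading them as binary numbers. The problem Edge-Majority: the input consists of two Boolean circuits $C\colon\{0,1\}^{n+m}\to\{0,1\}^{m+1}$ and $V\colon\{0,1\}^{m+1}\to\{0,1\}^{n+m}$ and an integer $k\geq1$; the question is whether there exists $x\in\{0,1\}^n$ such that for all $y\in\{0,1\}^m$ we have $V(C(x\Vert y))=xy$ and $C(x\Vert y)\geq k$. The class Polynomial Majority Argument is $\mathbf{PMA}=\{L\subseteq\Sigma^*: L\leq_P\text{Edge-Majority}\}$. The class $\mathbf{U\Sigma_2^P}$: a language $L\subseteq\Sigma^*$ is in $\mathbf{U\Sigma_2^P}$ if there is a polynomial-time Turing machine $M$ and a polynomial $p$ such that for all $w\in\Sigma^*$: (i) $w\in L\iff\exists x_1\,\forall x_2\; M(w,x_1,x_2)=1$, and (ii) there is at most one $x_1$ such that $\forall x_2\; M(w,x_1,x_2)=1$; here $x_1,x_2$ range over strings in $\Sigma^*$ with $|x_i|\leq p(|w|)$. -}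

module Defs where

open import Data.Bool.Base using (Bool; true; false; not; _∧_; _∨_)
open import Data.Fin.Base using (Fin; zero; toℕ; _↑ʳ_)
open import Data.List.Base as List using (List; []; _∷_; length; foldl; reverse)
open import Data.Maybe.Base as Maybe using (Maybe; just; nothing)
open import Data.Nat.Base using (ℕ; zero; suc; _+_; _*_; _≤_)
open import Data.Product.Base using (∃-syntax; Σ-syntax; _×_; _,_)
open import Data.Vec.Base as Vec using (Vec; []; _∷_; lookup; _++_; toList)
open import Function.Bundles using (_↔_; _⇔_)
open import Level using (0ℓ) renaming (suc to lsuc)
open import Relation.Binary.PropositionalEquality.Core using (_≡_)
open import Relation.Unary using (Pred; _∈_)

Word : Set
Word = List Bool

Language : Set₁
Language = Pred Word 0ℓ

ComplexityClass : Set₂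
ComplexityClass = Pred Language (lsuc 0ℓ)

-- Polynomials with natural coefficients, constant term first.
Polynomial : Set
Polynomial = List ℕ

⟦_⟧ : Polynomial → ℕ → ℕ
⟦ [] ⟧    n = 0
⟦ a ∷ p ⟧ n = a + n * ⟦ p ⟧ n

------------------------------------------------------------------------
-- Deterministic multitape Turing machines

Finite : Set → Set
Finite A = ∃[ n ] (A ↔ Fin n)

data Symbol (Extra : Set) : Set where
  blank : Symbol Extra
  bit   : Bool → Symbol Extra
  extra : Extra → Symbol Extra

data Move : Set where
  left stay right : Move

-- A tape is infinite in both directions; `before` (nearest cell first) and
-- `after` list the cells on either side of the head, and all cells beyond
-- the ends of the two lists are blank.
record Tape (Γ : Set) : Set where
  constructor tape
  field
    before : List Γ
    scan   : Γ
    after  : List Γ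

module _ {E : Set} where

  load : List (Symbol E) → Tape (Symbol E)
  load []       = tape [] blank []
  load (s ∷ ss) = tape [] s ss

  moveHead : Move → Tape (Symbol E) → Tape (Symbol E)
  moveHead stay  t                    = t
  moveHead left  (tape []       s rs) = tape [] blank (s ∷ rs)
  moveHead left  (tape (l ∷ ls) s rs) = tape ls l (s ∷ rs)
  moveHead right (tape ls s [])       = tape (s ∷ ls) blank []
  moveHead right (tape ls s (r ∷ rs)) = tape (s ∷ ls) r rs

  act : Symbol E × Move → Tape (Symbol E) → Tape (Symbol E)
  act (s , d) (tape ls _ rs) = moveHead d (tape ls s rs)

  leadingBits : List (Symbol E) → Word
  leadingBits (bit b ∷ ss) = b ∷ leadingBits ss
  leadingBits _            = []

  contents : Tape (Symbol E) → Word
  contents (tape _ s rs) = leadingBits (s ∷ rs)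

-- A machine taking `arity` input words, one on each of its first `arity`
-- tapes. The next tape is the output tape and `work` further tapes follow;
-- these are initially blank. The machine halts when `δ` yields `nothing`.
record TM (arity : ℕ) : Set₁ where
  field
    State        : Set
    Extra        : Set
    finiteState  : Finite State
    finiteExtra  : Finite Extra
    work         : ℕ

  tapes : ℕ
  tapes = arity + suc work

  Γ : Set
  Γ = Symbol Extra

  field
    start : State
    δ     : State → Vec Γ tapes → Maybe (State × Vec (Γ × Move) tapes)

  Config : Set
  Config = State × Vec (Tape Γ) tapes

  initial : Vec Word arity → Config
  initial ws =
    start , Vec.map (λ w → load (List.map bit w)) ws ++ Vec.replicate (suc work) (load [])

  step : Config → Maybe Config
  step (q , ts) =
    Maybe.map (λ (q′ , as) → q′ , Vec.zipWith act as ts) (δ q (Vec.map Tape.scan ts))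

  -- c ⇓[ t ] d : from c the machine makes exactly t steps and halts in d.
  data _⇓[_]_ : Config → ℕ → Config → Set where
    halt : ∀ {c} → step c ≡ nothing → c ⇓[ 0 ] c
    next : ∀ {c c′ t d} → step c ≡ just c′ → c′ ⇓[ t ] d → c ⇓[ suc t ] d

  -- The output is the block of bits starting under the head of the output tape.
  output : Config → Word
  output (_ , ts) = contents (lookup ts (arity ↑ʳ zero))

  Outputs : Vec Word arity → Word → Set
  Outputs ws v = ∃[ t ] ∃[ d ] (initial ws ⇓[ t ] d × output d ≡ v)

  PolyTime : Set
  PolyTime = Σ[ p ∈ Polynomial ] ∀ ws → ∃[ t ] ∃[ d ]
    (initial ws ⇓[ t ] d × t ≤ ⟦ p ⟧ (Vec.sum (Vec.map length ws)))

open TM public using (Outputs; PolyTime)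

infix 4 _≤ₚ_

record _≤ₚ_ (A B : Language) : Set₁ where
  field
    machine  : TM 1
    polyTime : PolyTime machine
    f        : Word → Word
    computes : ∀ w → Outputs machine (w ∷ []) (f w)
    correct  : ∀ w → w ∈ A ⇔ f w ∈ B

record UΣ₂P (L : Language) : Set₁ where
  field
    M        : TM 3
    polyTime : PolyTime M
    p        : Polynomial

  Short : Word → Word → Set
  Short w x = length x ≤ ⟦ p ⟧ (length w)

  Winning : Word → Word → Set
  Winning w x₁ = ∀ x₂ → Short w x₂ → Outputs M (w ∷ x₁ ∷ x₂ ∷ []) (true ∷ [])

  field
    correct : ∀ w → w ∈ L ⇔ (∃[ x₁ ] (Short w x₁ × Winning w x₁))
    unique  : ∀ w x₁ x₁′ → Short w x₁ → Short w x₁′ →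
              Winning w x₁ → Winning w x₁′ → x₁ ≡ x₁′

------------------------------------------------------------------------
-- Boolean circuits

data Gate (w : ℕ) : Set where
  const   : Bool → Gate w
  neg     : Fin w → Gate w
  and or  : Fin w → Fin w → Gate w

-- A circuit over w available wires is a list of gates in topological order
-- followed by the choice of output wires. The wire produced by a gate gets
-- index 0 in the rest of the circuit, and all older wires shift up by one.
infixr 5 _▹_

data Circuit (w o : ℕ) : Set where
  outputs : Vec (Fin w) o → Circuit w o
  _▹_     : Gate w → Circuit (suc w) o → Circuit w o

evalGate : ∀ {w} → Gate w → Vec Bool w → Bool
evalGate (const b) v = b
evalGate (neg i)   v = not (lookup v i)
evalGate (and i j) v = lookup v i ∧ lookup v j
evalGate (or i j)  v = lookup v i ∨ lookup v j

eval : ∀ {w o} → Circuit w o → Vec Bool w → Vec Bool o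
eval (outputs is) v = Vec.map (lookup v) is
eval (g ▹ c)      v = eval c (evalGate g v ∷ v)

------------------------------------------------------------------------
-- Binary numbers, most significant bit first

bitValue : Bool → ℕ
bitValue false = 0
bitValue true  = 1

value : Word → ℕ
value = foldl (λ a b → 2 * a + bitValue b) 0

-- Increment, least significant bit first.
increment : Word → Word
increment []           = true ∷ []
increment (false ∷ bs) = true ∷ bs
increment (true ∷ bs)  = false ∷ increment bs

binaryLSB : ℕ → Word
binaryLSB zero    = []
binaryLSB (suc n) = increment (binaryLSB n)

binary : ℕ → Word
binary n = reverse (binaryLSB n)

------------------------------------------------------------------------
-- Edge-Majority

record Instance : Set where
  field
    n m : ℕ
    C   : Circuit (n + m) (suc m)
    V   : Circuit (suc m) (n + m)
    k   : ℕ
    k≥1 : 1 ≤ k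

YesInstance : Instance → Set
YesInstance I = Σ[ x ∈ Vec Bool n ] ∀ (y : Vec Bool m) →
    eval V (eval C (x ++ y)) ≡ x ++ y
  × k ≤ value (toList (eval C (x ++ y)))
  where open Instance I

-- The encoding is a concatenation of self-delimiting blocks, with the binary
-- expansion of k last. The arities n, m and the wire indices are in unary:
-- an encoding of V has to list n + m output wires anyway, and a wire index
-- is less than the number of inputs plus the number of gates, so this is
-- polynomially equivalent to writing them in binary.
unary : ℕ → Word
unary zero    = false ∷ []
unary (suc n) = true ∷ unary n

encodeWire : ∀ {w} → Fin w → Word
encodeWire i = unary (toℕ i)

encodeGate : ∀ {w} → Gate w → Word
encodeGate (const b) = false ∷ false ∷ b ∷ []
encodeGate (neg i)   = false ∷ true ∷ encodeWire i
encodeGate (and i j) = true ∷ false ∷ encodeWire i List.++ encodeWire j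
encodeGate (or i j)  = true ∷ true ∷ encodeWire i List.++ encodeWire j

encodeCircuit : ∀ {w o} → Circuit w o → Word
encodeCircuit (outputs is) = false ∷ List.concat (List.map encodeWire (toList is))
encodeCircuit (g ▹ c)      = true ∷ encodeGate g List.++ encodeCircuit c

encode : Instance → Word
encode I = unary n List.++ unary m List.++ encodeCircuit C List.++ encodeCircuit V
           List.++ binary k
  where open Instance I

EdgeMajority : Language
EdgeMajority s = Σ[ I ∈ Instance ] (s ≡ encode I × YesInstance I)

PMA : ComplexityClass
PMA L = L ≤ₚ EdgeMajority

{-# OPTIONS --safe #-}

-- Given a reduction f to Edge-Majority, the machine for UΣ₂P computes f w and
-- checks, with x₁ as x and x₂ as y, that f w is an instance with |x| = n and that
-- V(C(xy)) = xy and C(xy) ≥ k; if |x₂| ≠ m then x₂ is no y and it accepts. Gates and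
-- wire indices are evaluated while f w is read once from left to right, the values of the
-- wires forming a stack. A wire index i is written in unary, so looking it up takes a
-- number of steps proportional to the length of its code, and the running time is linear in
-- |f w| + |x₁| + |x₂| once f w is computed.
--
-- At most one x₁ wins: if x ≠ x′ did, then C would map the 2^(m+1) words xy and x′y to
-- words of length m+1 injectively, as V inverts it, but it avoids the word of value 0.
module Submission where

open import Defs
open import Relation.Unary using (_⊆_)

open import Data.Bool.Base using (Bool; true; false; not; _∧_; _∨_; if_then_else_)
open import Data.Bool.Properties as Bool using ()
open import Data.Empty using (⊥-elim)
open import Data.Fin.Base using (Fin; zero; suc; _↑ʳ_)
open import Data.Fin.Properties as Fin using (+↔⊎; *↔×; 1↔⊤; 2↔Bool; pigeonhole)
open import Data.List.Base as List using (List; []; _∷_; _++_; _ʳ++_; length; foldl)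
open import Data.List.Properties
  using (++-assoc; ++-identityʳ; ++-cancelˡ; ʳ++-ʳ++; length-ʳ++; length-++-≤ʳ; length-replicate;
         ∷-injectiveˡ; ∷-injectiveʳ)
open import Data.List.Relation.Unary.All using (All; []; _∷_)
open import Data.Maybe.Base as Maybe using (Maybe; just; nothing; maybe′)
open import Data.Nat.Base using (ℕ; zero; suc; _+_; _*_; _^_; _≤_; _<_; z≤n; s≤s; s≤s⁻¹)
open import Data.Nat.Properties
open import Data.Nat.Tactic.RingSolver using (solve-∀)
open import Data.Product.Base using (∃; ∃₂; ∃-syntax; _×_; _,_; proj₁; proj₂; map₁)
open import Data.Product.Function.NonDependent.Propositional using (_×-↔_)
open import Data.Sum.Base as Sum using (_⊎_; inj₁; inj₂)
open import Data.Sum.Function.Propositional using (_⊎-↔_)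
open import Data.Unit.Base using (⊤; tt)
open import Data.Vec.Base as Vec using (Vec; []; _∷_; lookup; toList; _[_]≔_)
open import Data.Vec.Properties as Vec
  using (lookup∘update; lookup-map; lookup-zipWith; []≔-idempotent; toList-++; toList-cast;
         toList∘fromList; length-toList; ++-injectiveˡ; ++-injectiveʳ)
open import Function.Bundles using (_↔_; mk⇔; mk↔ₛ′; Inverse; Injection; Equivalence)
open import Function.Construct.Composition using (_↔-∘_)
open import Function.Construct.Symmetry using (↔-sym)
open import Function.Properties.Inverse using (↔⇒↣)
open import Relation.Binary.PropositionalEquality
open import Relation.Nullary using (¬_; Dec; yes; no; contradiction; Reflects; ofʸ; ofⁿ)

-- Two obstacles shape the proof. A winning word has to certify that `f w` is an encoding at all,
-- although every x₂ of the wrong length is accepted. So some short x₂ must expose a malformed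
-- `f w`: the word 0^m if the second header is 1^m 0, and likewise if it is 1^m without an end,
-- where an x₂ of that length is rejected. These lengths are at most |f w|, which exceeds the
-- running time of the reduction by at most one; hence a polynomial bound on |f w| also serves as
-- the bound on x₁ and x₂.
--
-- The machine is compiled from a small structured language instead of being given by a transition
-- table. `Run` is a big-step semantics with a step budget, so each lemma settles result and time
-- together. Lemmas such as `gates-run` follow a given circuit; those such as `gates-total` start
-- from an arbitrary word, which either parses or makes the program fail, so that the instance is
-- recovered from a run that does not fail.

-- Structured programs on bit tapes and their budgeted semantics

Result : Set
Result = Maybe Bool

Register : Set
Register = Fin 4

pattern X = zero
pattern Y = suc zero
pattern W = suc (suc zero)
pattern K = suc (suc (suc zero))

-- (u , v) is a tape with u to the left of the head, nearest cell first, and v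
-- starting under the head, surrounded by blanks.
Zipper : Set
Zipper = Word × Word

data Op : Set where
  pop back gap : Op
  push         : Bool → Op

-- `push` moves left and overwrites the cell there, hence `drop 1`. `gap` also moves left; if there
-- are no bits, it lands on a blank, which separates the old `v` from all that is pushed later.
⟦_⟧ₒ : Op → Zipper → Result × Zipper
⟦ pop ⟧ₒ    (u , [])    = nothing , (u , [])
⟦ pop ⟧ₒ    (u , b ∷ v) = just b , (b ∷ u , v)
⟦ back ⟧ₒ   ([] , v)    = nothing , ([] , v)
⟦ back ⟧ₒ   (b ∷ u , v) = just b , (u , b ∷ v)
⟦ gap ⟧ₒ    ([] , v)    = just true , ([] , [])
⟦ gap ⟧ₒ    (b ∷ u , v) = just true , (u , b ∷ v)
⟦ push b ⟧ₒ (u , v)     = just true , (List.drop 1 u , b ∷ v)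

infixl 1 _>>=_ _>>?_

-- `loop p` repeats p as long as p returns `just true`; `nothing` mostly means rejection.
data Prog : Set where
  ret   : Result → Prog
  read  : Prog
  on    : Register → Op → Prog
  _>>=_ : Prog → (Result → Prog) → Prog
  loop  : Prog → Prog

_>>?_ : Prog → (Bool → Prog) → Prog
p >>? f = p >>= maybe′ f (ret nothing)

-- The registers together with the part of the input tape not read so far.
Store : Set
Store = Vec Zipper 4 × Word

-- A store with a hole at register `i`. Stating `Run` for `F z` lets an operation update the hole by
-- computation.
record Lens (i : Register) (F : Zipper → Vec Zipper 4) : Set where
  constructor lens
  field
    get : ∀ z → lookup (F z) i ≡ z
    put : ∀ z z′ → F z [ i ]≔ z′ ≡ F z′

-- Search through these finds n ≤ k + n for a numeral k. It is ambiguous if the smaller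
-- side is itself a successor; `retain` below gives k explicitly in that case.
instance
  ≤-here : ∀ {n} → n ≤ n
  ≤-here = ≤-refl

  ≤-there : ∀ {m n} → ⦃ m ≤ n ⦄ → m ≤ suc n
  ≤-there ⦃ m≤n ⦄ = m≤n⇒m≤1+n m≤n

-- Run p σ n r σ′ n′: started in σ with a budget of n steps, p exits with
-- result r in σ′ and leaves a budget of n′.
data Run : Prog → Store → ℕ → Result → Store → ℕ → Set where
  ret   : ∀ {r σ n n′} → ⦃ n′ ≤ n ⦄ → Run (ret r) σ (suc n) r σ n′
  read  : ∀ {zs s n} → Run read (zs , s) (2 + n) (List.head s) (zs , List.drop 1 s) n
  on    : ∀ {i F z s n} op → Lens i F →
          Run (on i op) (F z , s) (2 + n) (proj₁ (⟦ op ⟧ₒ z)) (F (proj₂ (⟦ op ⟧ₒ z)) , s) n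
  _>>=_ : ∀ {p f σ σ′ σ″ r r′ n n′ n″} →
          Run p σ n r σ′ n′ → Run (f r) σ′ n′ r′ σ″ n″ → Run (p >>= f) σ n r′ σ″ n″
  again : ∀ {p σ σ′ σ″ r n n′ n″} →
          Run p σ n (just true) σ′ n′ → Run (loop p) σ′ n′ r σ″ n″ → Run (loop p) σ n r σ″ n″
  leave : ∀ {p σ σ′ r n n′} → Run p σ n r σ′ n′ → r ≢ just true → Run (loop p) σ n r σ′ n′
  waste : ∀ {p σ σ′ r m n n′} → m ≤ n → Run p σ m r σ′ n′ → Run p σ n r σ′ n′

-- Compilation to Turing machines

finite-⊤ : Finite ⊤
finite-⊤ = 1 , ↔-sym 1↔⊤

finite-Bool : Finite Bool
finite-Bool = 2 , ↔-sym 2↔Bool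

finite-⊎ : ∀ {A B} → Finite A → Finite B → Finite (A ⊎ B)
finite-⊎ (m , A↔m) (n , B↔n) = m + n , ↔-sym +↔⊎ ↔-∘ (A↔m ⊎-↔ B↔n)

-- The control states. A continuation is instantiated at each of the three results, so a bit that
-- was read is remembered in the state and the states stay finite. The `Bool` of an operation is its
-- phase.
data Pos : Prog → Set where
  atRet  : ∀ {r} → Pos (ret r)
  atRead : Bool → Pos read
  atOp   : ∀ {i op} → Bool → Pos (on i op)
  first  : ∀ {p f} → Pos p → Pos (p >>= f)
  branch : ∀ {p f} r → Pos (f r) → Pos (p >>= f)
  inside : ∀ {p} → Pos p → Pos (loop p)

finite-↔ : ∀ {A B} → B ↔ A → Finite A → Finite B
finite-↔ B↔A (n , A↔n) = n , A↔n ↔-∘ B↔A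

finite-Pos : ∀ p → Finite (Pos p)
finite-Pos (ret r)   =
  finite-↔ (mk↔ₛ′ (λ _ → tt) (λ _ → atRet) (λ _ → refl) (λ { atRet → refl })) finite-⊤
finite-Pos read      =
  finite-↔ (mk↔ₛ′ (λ { (atRead a) → a }) atRead (λ _ → refl) (λ { (atRead a) → refl })) finite-Bool
finite-Pos (on i o)  =
  finite-↔ (mk↔ₛ′ (λ { (atOp a) → a }) atOp (λ _ → refl) (λ { (atOp a) → refl })) finite-Bool
finite-Pos (p >>= f) =
  finite-↔ (mk↔ₛ′ to from to∘from from∘to)
    (finite-⊎ (finite-Pos p) (finite-⊎ (finite-Pos (f nothing))
      (finite-⊎ (finite-Pos (f (just false))) (finite-Pos (f (just true))))))
  where
  Parts = Pos p ⊎ Pos (f nothing) ⊎ Pos (f (just false)) ⊎ Pos (f (just true))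

  to : Pos (p >>= f) → Parts
  to (first a)               = inj₁ a
  to (branch nothing a)      = inj₂ (inj₁ a)
  to (branch (just false) a) = inj₂ (inj₂ (inj₁ a))
  to (branch (just true) a)  = inj₂ (inj₂ (inj₂ a))

  from : Parts → Pos (p >>= f)
  from (inj₁ a)               = first a
  from (inj₂ (inj₁ a))        = branch nothing a
  from (inj₂ (inj₂ (inj₁ a))) = branch (just false) a
  from (inj₂ (inj₂ (inj₂ a))) = branch (just true) a

  to∘from : ∀ a → to (from a) ≡ a
  to∘from (inj₁ a)               = refl
  to∘from (inj₂ (inj₁ a))        = refl
  to∘from (inj₂ (inj₂ (inj₁ a))) = refl
  to∘from (inj₂ (inj₂ (inj₂ a))) = refl

  from∘to : ∀ a → from (to a) ≡ a
  from∘to (first a)               = refl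
  from∘to (branch nothing a)      = refl
  from∘to (branch (just false) a) = refl
  from∘to (branch (just true) a)  = refl
finite-Pos (loop p)  =
  finite-↔ (mk↔ₛ′ (λ { (inside a) → a }) inside (λ _ → refl) (λ { (inside a) → refl })) (finite-Pos p)

enter : ∀ p → Pos p
enter (ret r)   = atRet
enter read      = atRead false
enter (on i o)  = atOp false
enter (p >>= f) = first (enter p)
enter (loop p)  = inside (enter p)

add-≤ : ∀ t {t′ n n′ n″} → t′ + n″ ≤ n′ → t + n′ ≤ n → (t + t′) + n″ ≤ n
add-≤ t {t′} {n} {n′} {n″} t′≤ t≤ = begin
  (t + t′) + n″ ≡⟨ +-assoc t t′ n″ ⟩
  t + (t′ + n″) ≤⟨ +-monoʳ-≤ t t′≤ ⟩
  t + n′        ≤⟨ t≤ ⟩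
  n             ∎
  where open ≤-Reasoning

module Compilation (E : Set) (rest : ℕ) where

  Γ : Set
  Γ = Symbol E

  Tapes Scans Actions : Set
  Tapes   = Vec (Tape Γ) (7 + rest)
  Scans   = Vec Γ (7 + rest)
  Actions = Vec (Γ × Move) (7 + rest)

  idle : ∀ {n} → Vec Γ n → Vec (Γ × Move) n
  idle = Vec.map (_, stay)

  -- The tapes are the three inputs, the output, W, K and the input tape of `read`.
  register : Register → Fin (7 + rest)
  register X = suc zero
  register Y = suc (suc zero)
  register W = suc (suc (suc (suc zero)))
  register K = suc (suc (suc (suc (suc zero))))

  source : Fin (7 + rest)
  source = suc (suc (suc (suc (suc (suc zero)))))

  -- Phase `false` brings the head of `back` and `push` to the cell on the left. A `back` that finds
  -- no bit there returns in its second step, so that its failure leaves the zipper unchanged.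
  opδ : Op → Bool → Γ → (Bool ⊎ Result) × (Γ × Move)
  opδ pop      _     (bit b) = inj₂ (just b) , (bit b , right)
  opδ pop      _     g       = inj₂ nothing , (g , stay)
  opδ back     false g       = inj₁ true , (g , left)
  opδ back     true  (bit b) = inj₂ (just b) , (bit b , stay)
  opδ back     true  g       = inj₂ nothing , (g , right)
  opδ gap      _     g       = inj₂ (just true) , (g , left)
  opδ (push b) false g       = inj₁ true , (g , left)
  opδ (push b) true  g       = inj₂ (just true) , (bit b , stay)

  onTape : Fin (7 + rest) → Op → Bool → Scans → (Bool ⊎ Result) × Actions
  onTape j op a gs = let (e , α) = opδ op a (lookup gs j) in e , idle gs [ j ]≔ α

  enterBranch : ∀ {p} f → Pos p ⊎ Result → Pos (p >>= f) ⊎ Result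
  enterBranch f (inj₁ a) = inj₁ (first a)
  enterBranch f (inj₂ r) = inj₁ (branch r (enter (f r)))

  repeat : ∀ p → Pos p ⊎ Result → Pos (loop p) ⊎ Result
  repeat p (inj₁ a)            = inj₁ (inside a)
  repeat p (inj₂ (just true))  = inj₁ (inside (enter p))
  repeat p (inj₂ (just false)) = inj₂ (just false)
  repeat p (inj₂ nothing)      = inj₂ nothing

  δP : ∀ {p} → Pos p → Scans → (Pos p ⊎ Result) × Actions
  δP {ret r}   atRet        gs = inj₂ r , idle gs
  δP {read}    (atRead a)   gs = map₁ (Sum.map₁ atRead) (onTape source pop a gs)
  δP {on i op} (atOp a)     gs = map₁ (Sum.map₁ atOp) (onTape (register i) op a gs)
  δP {p >>= f} (first a)    gs = map₁ (enterBranch f) (δP a gs)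
  δP {p >>= f} (branch r a) gs = map₁ (Sum.map₁ (branch r)) (δP a gs)
  δP {loop p}  (inside a)   gs = map₁ (repeat p) (δP a gs)

  perform : Actions → Tapes → Tapes
  perform = Vec.zipWith act

  data Exec {p : Prog} (a : Pos p) (ts : Tapes) : ℕ → Result → Tapes → Set where
    exit : ∀ {r αs} → δP a (Vec.map Tape.scan ts) ≡ (inj₂ r , αs) →
           Exec a ts 1 r (perform αs ts)
    go   : ∀ {b αs t r ts′} → δP a (Vec.map Tape.scan ts) ≡ (inj₁ b , αs) →
           Exec b (perform αs ts) t r ts′ → Exec a ts (suc t) r ts′

  Exec-branch : ∀ {p f} r {a : Pos (f r)} {ts t r′ ts′} → Exec a ts t r′ ts′ →
                Exec (branch {p} {f} r a) ts t r′ ts′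
  Exec-branch r (exit eq) = exit (cong (map₁ (Sum.map₁ (branch r))) eq)
  Exec-branch r (go eq e) = go (cong (map₁ (Sum.map₁ (branch r))) eq) (Exec-branch r e)

  -- The last transition of `p` already enters `f r`, so sequencing has no cost of its own.
  Exec-bind : ∀ {p} f {r} {a : Pos p} {ts t t′ r′ ts′ ts″} → Exec a ts t r ts′ →
              Exec (enter (f r)) ts′ t′ r′ ts″ → Exec (first {f = f} a) ts (t + t′) r′ ts″
  Exec-bind f (exit eq) e′ = go (cong (map₁ (enterBranch f)) eq) (Exec-branch _ e′)
  Exec-bind f (go eq e) e′ = go (cong (map₁ (enterBranch f)) eq) (Exec-bind f e e′)

  Exec-again : ∀ {p} {a : Pos p} {ts t t′ r′ ts′ ts″} → Exec a ts t (just true) ts′ →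
               Exec (inside (enter p)) ts′ t′ r′ ts″ → Exec (inside a) ts (t + t′) r′ ts″
  Exec-again (exit eq) e′ = go (cong (map₁ (repeat _)) eq) e′
  Exec-again (go eq e) e′ = go (cong (map₁ (repeat _)) eq) (Exec-again e e′)

  repeat-leave : ∀ p {r} → r ≢ just true → repeat p (inj₂ r) ≡ inj₂ r
  repeat-leave p {nothing}    _ = refl
  repeat-leave p {just false} _ = refl
  repeat-leave p {just true}  r≢ with () ← r≢ refl

  Exec-leave : ∀ {p} {a : Pos p} {ts t r ts′} → Exec a ts t r ts′ → r ≢ just true →
               Exec (inside a) ts t r ts′
  Exec-leave (exit {αs = αs} eq) r≢ =
    exit (trans (cong (map₁ (repeat _)) eq) (cong (_, αs) (repeat-leave _ r≢)))
  Exec-leave (go eq e) r≢ = go (cong (map₁ (repeat _)) eq) (Exec-leave e r≢)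

  -- Stepping left off the end of a tape and back again leaves an explicit blank in `before`, so the
  -- bits may be followed by any number of blanks.
  data Behind : List Γ → Word → Set where
    []  : ∀ {ls} → All (_≡ blank) ls → Behind ls []
    _∷_ : ∀ b {ls u} → Behind ls u → Behind (bit b ∷ ls) (b ∷ u)

  _Holds_ : Tape Γ → Zipper → Set
  t Holds (u , v) = Behind (Tape.before t) u × contents t ≡ v

  data OpRun (op : Op) (t : Tape Γ) (r : Result) (t′ : Tape Γ) : Set where
    one : ∀ {α} → opδ op false (Tape.scan t) ≡ (inj₂ r , α) → act α t ≡ t′ → OpRun op t r t′
    two : ∀ {α β t₁} → opδ op false (Tape.scan t) ≡ (inj₁ true , α) → act α t ≡ t₁ →
          opδ op true (Tape.scan t₁) ≡ (inj₂ r , β) → act β t₁ ≡ t′ → OpRun op t r t′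

  contents-right : ∀ (l : Γ) ls rs → contents (moveHead right (tape ls l rs)) ≡ leadingBits rs
  contents-right l ls []       = refl
  contents-right l ls (r ∷ rs) = refl

  before-right : ∀ (l : Γ) ls rs → Tape.before (moveHead right (tape ls l rs)) ≡ l ∷ ls
  before-right l ls []       = refl
  before-right l ls (r ∷ rs) = refl

  opRun-pop-bit : ∀ {t b v} → contents t ≡ b ∷ v → ∃[ t′ ] OpRun pop t (just b) t′ ×
                  Tape.before t′ ≡ bit b ∷ Tape.before t × contents t′ ≡ v
  opRun-pop-bit {tape ls (bit b) rs} refl =
    _ , one refl refl , before-right (bit b) ls rs , contents-right (bit b) ls rs

  opRun-pop-end : ∀ {t} → contents t ≡ [] → OpRun pop t nothing t
  opRun-pop-end {tape ls blank rs}     _ = one refl refl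
  opRun-pop-end {tape ls (extra x) rs} _ = one refl refl

  opRun : ∀ op {t z} → t Holds z →
          ∃[ t′ ] OpRun op t (proj₁ (⟦ op ⟧ₒ z)) t′ × t′ Holds proj₂ (⟦ op ⟧ₒ z)
  opRun pop {t} {u , []} (bh , ct) = t , opRun-pop-end ct , bh , ct
  opRun pop {t} {u , b ∷ v} (bh , ct) with opRun-pop-bit {t} ct
  ... | t′ , run , eq , ct′ = t′ , run , subst (λ ls → Behind ls (b ∷ u)) (sym eq) (b ∷ bh) , ct′
  opRun back {tape _ s rs} (b ∷ bh , ct) = _ , two refl refl refl refl , bh , cong (b ∷_) ct
  opRun back {tape _ s rs} ([] [] , ct) = _ , two refl refl refl refl , [] (refl ∷ []) , ct
  opRun back {tape _ s rs} ([] (refl ∷ bs) , ct) = _ , two refl refl refl refl , [] (refl ∷ bs) , ct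
  opRun gap {tape _ s rs} (b ∷ bh , ct) = _ , one refl refl , bh , cong (b ∷_) ct
  opRun gap {tape _ s rs} ([] [] , ct) = _ , one refl refl , [] [] , refl
  opRun gap {tape _ s rs} ([] (refl ∷ bs) , ct) = _ , one refl refl , [] bs , refl
  opRun (push b) {tape _ s rs} (c ∷ bh , ct) = _ , two refl refl refl refl , bh , cong (b ∷_) ct
  opRun (push b) {tape _ s rs} ([] [] , ct) = _ , two refl refl refl refl , [] [] , cong (b ∷_) ct
  opRun (push b) {tape _ s rs} ([] (refl ∷ bs) , ct) = _ , two refl refl refl refl , [] bs , cong (b ∷_) ct

  onTape-≡ : ∀ {op a j e α} ts → opδ op a (Tape.scan (lookup ts j)) ≡ (e , α) →
             onTape j op a (Vec.map Tape.scan ts) ≡ (e , idle (Vec.map Tape.scan ts) [ j ]≔ α)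
  onTape-≡ {op} {a} {j} ts eq rewrite lookup-map j Tape.scan ts | eq = refl

  perform-idle : ∀ {n} (ts : Vec (Tape Γ) n) → Vec.zipWith act (idle (Vec.map Tape.scan ts)) ts ≡ ts
  perform-idle []       = refl
  perform-idle (t ∷ ts) = cong (t ∷_) (perform-idle ts)

  perform-at : ∀ {n} (j : Fin n) α (ts : Vec (Tape Γ) n) →
               Vec.zipWith act (idle (Vec.map Tape.scan ts) [ j ]≔ α) ts ≡ ts [ j ]≔ act α (lookup ts j)
  perform-at zero    α (t ∷ ts) = cong (_ ∷_) (perform-idle ts)
  perform-at (suc j) α (t ∷ ts) = cong (t ∷_) (perform-at j α ts)

  -- Abstracting over `position` lets `read` and `on` share the argument.
  opExec : ∀ {p op j ts r t′} (position : Bool → Pos p) →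
           (∀ a gs → δP (position a) gs ≡ map₁ (Sum.map₁ position) (onTape j op a gs)) →
           OpRun op (lookup ts j) r t′ →
           ∃[ n ] n ≤ 2 × Exec (position false) ts n r (ts [ j ]≔ t′)
  opExec {op = op} {j} {ts} {r} position δ≡ (one {α} eq refl) =
    1 , s≤s z≤n ,
    subst (Exec _ ts 1 r) (perform-at j α ts)
      (exit (trans (δ≡ false _) (cong (map₁ (Sum.map₁ position)) (onTape-≡ ts eq))))
  opExec {op = op} {j} {ts} {r} {t′} position δ≡ (two {α} {β} {t₁} eq refl eq′ refl) =
    2 , ≤-refl , go (trans (δ≡ false _) (cong (map₁ (Sum.map₁ position)) (onTape-≡ ts eq)))
      (subst₂ (λ us → Exec _ us 1 r) (sym (perform-at j α ts)) after
        (exit (trans (δ≡ true _) (cong (map₁ (Sum.map₁ position)) (onTape-≡ ts₁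
          (subst (λ t → opδ op true (Tape.scan t) ≡ (inj₂ r , β)) (sym (lookup∘update j ts t₁)) eq′))))))
    where
    ts₁ = ts [ j ]≔ t₁
    after : perform (idle (Vec.map Tape.scan ts₁) [ j ]≔ β) ts₁ ≡ ts [ j ]≔ act β t₁
    after = begin
      perform (idle (Vec.map Tape.scan ts₁) [ j ]≔ β) ts₁ ≡⟨ perform-at j β ts₁ ⟩
      ts₁ [ j ]≔ act β (lookup ts₁ j)                     ≡⟨ []≔-idempotent ts j ⟩
      ts [ j ]≔ act β (lookup ts₁ j)
        ≡⟨ cong (λ t → ts [ j ]≔ act β t) (lookup∘update j ts t₁) ⟩
      ts [ j ]≔ act β t₁                                  ∎
      where open ≡-Reasoning

  -- The reduction may leave anything to the left of its output, so the source tape is described by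
  -- its contents alone. The output tape has to stay blank until the answer is written.
  Realises : Tapes → Store → Set
  Realises (w ∷ x ∷ y ∷ o ∷ v ∷ k ∷ s ∷ _) (zs , ws) =
    (x Holds lookup zs X) × (y Holds lookup zs Y) × (v Holds lookup zs W) × (k Holds lookup zs K) ×
    o ≡ load [] × contents s ≡ ws

  holds : ∀ i {ts zs s} → Realises ts (zs , s) → lookup ts (register i) Holds lookup zs i
  holds X {_ ∷ _ ∷ _ ∷ _ ∷ _ ∷ _ ∷ _ ∷ _} (x , y , v , k , o , s) = x
  holds Y {_ ∷ _ ∷ _ ∷ _ ∷ _ ∷ _ ∷ _ ∷ _} (x , y , v , k , o , s) = y
  holds W {_ ∷ _ ∷ _ ∷ _ ∷ _ ∷ _ ∷ _ ∷ _} (x , y , v , k , o , s) = v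
  holds K {_ ∷ _ ∷ _ ∷ _ ∷ _ ∷ _ ∷ _ ∷ _} (x , y , v , k , o , s) = k

  Realises-update : ∀ i {ts zs s t z} → Realises ts (zs , s) → t Holds z →
                    Realises (ts [ register i ]≔ t) (zs [ i ]≔ z , s)
  Realises-update X {_ ∷ _ ∷ _ ∷ _ ∷ _ ∷ _ ∷ _ ∷ _} {_ ∷ _ ∷ _ ∷ _ ∷ []}
    (x , y , v , k , o , s) h = h , y , v , k , o , s
  Realises-update Y {_ ∷ _ ∷ _ ∷ _ ∷ _ ∷ _ ∷ _ ∷ _} {_ ∷ _ ∷ _ ∷ _ ∷ []}
    (x , y , v , k , o , s) h = x , h , v , k , o , s
  Realises-update W {_ ∷ _ ∷ _ ∷ _ ∷ _ ∷ _ ∷ _ ∷ _} {_ ∷ _ ∷ _ ∷ _ ∷ []}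
    (x , y , v , k , o , s) h = x , y , h , k , o , s
  Realises-update K {_ ∷ _ ∷ _ ∷ _ ∷ _ ∷ _ ∷ _ ∷ _} {_ ∷ _ ∷ _ ∷ _ ∷ []}
    (x , y , v , k , o , s) h = x , y , v , h , o , s

  Realises-read : ∀ {ts zs s t s′} → Realises ts (zs , s) → contents t ≡ s′ →
                  Realises (ts [ source ]≔ t) (zs , s′)
  Realises-read {_ ∷ _ ∷ _ ∷ _ ∷ _ ∷ _ ∷ _ ∷ _} (x , y , v , k , o , s) h = x , y , v , k , o , h

  unread : ∀ {ts zs s} → Realises ts (zs , s) → contents (lookup ts source) ≡ s
  unread {_ ∷ _ ∷ _ ∷ _ ∷ _ ∷ _ ∷ _ ∷ _} (x , y , v , k , o , s) = s

  opRun-read : ∀ {t s} → contents t ≡ s →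
               ∃[ t′ ] OpRun pop t (List.head s) t′ × contents t′ ≡ List.drop 1 s
  opRun-read {t} {[]}    ct = t , opRun-pop-end ct , ct
  opRun-read {t} {b ∷ s} ct = let t′ , run , _ , ct′ = opRun-pop-bit {t} ct in t′ , run , ct′

  -- An operation is charged two steps but may take one, and budget may be discarded; hence an
  -- inequality for the time.
  Exec-Run : ∀ {p σ n r σ′ n′ ts} → Run p σ n r σ′ n′ → Realises ts σ →
             ∃₂ λ t ts′ → Exec (enter p) ts t r ts′ × Realises ts′ σ′ × t + n′ ≤ n
  Exec-Run {σ = σ} {ts = ts} (ret ⦃ n′≤n ⦄) R =
    1 , _ , exit refl , subst (λ us → Realises us σ) (sym (perform-idle ts)) R , s≤s n′≤n
  Exec-Run (read {n = n}) R with opRun-read (unread R)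
  ... | t′ , run , ct with opExec atRead (λ _ _ → refl) run
  ...   | t , t≤2 , e = t , _ , e , Realises-read R ct , +-monoˡ-≤ n t≤2
  Exec-Run {ts = ts} (on {i} {F} {z} {s} {n} op (lens get put)) R
    with opRun op (subst (lookup ts (register i) Holds_) (get z) (holds i R))
  ... | t′ , run , h with opExec atOp (λ _ _ → refl) run
  ...   | t , t≤2 , e = t , _ , e ,
    subst (λ zs → Realises _ (zs , s)) (put z _) (Realises-update i R h) , +-monoˡ-≤ n t≤2
  Exec-Run (_>>=_ {f = f} ρ ρ′) R with Exec-Run ρ R
  ... | t , _ , e , R′ , t≤ with Exec-Run ρ′ R′
  ...   | t′ , _ , e′ , R″ , t′≤ = t + t′ , _ , Exec-bind f e e′ , R″ , add-≤ t t′≤ t≤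
  Exec-Run (again ρ ρ′) R with Exec-Run ρ R
  ... | t , _ , e , R′ , t≤ with Exec-Run ρ′ R′
  ...   | t′ , _ , e′ , R″ , t′≤ = t + t′ , _ , Exec-again e e′ , R″ , add-≤ t t′≤ t≤
  Exec-Run (leave ρ r≢) R with Exec-Run ρ R
  ... | t , _ , e , R′ , t≤ = t , _ , Exec-leave e r≢ , R′ , t≤
  Exec-Run (waste m≤n ρ) R with Exec-Run ρ R
  ... | t , _ , e , R′ , t≤ = t , _ , e , R′ , ≤-trans t≤ m≤n

-- Evaluation of encoded circuits

-- length s * c + n, by a recursion that unfolds definitionally as s is read.
pay : ℕ → Word → ℕ → ℕ
pay c []      n = n
pay c (_ ∷ s) n = c + pay c s n

pay-+ : ∀ c s d n → pay c s (d + n) ≡ d + pay c s n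
pay-+ c []      d n = refl
pay-+ c (_ ∷ s) d n = begin
  c + pay c s (d + n)   ≡⟨ cong (c +_) (pay-+ c s d n) ⟩
  c + (d + pay c s n)   ≡⟨ +-assoc c d _ ⟨
  c + d + pay c s n     ≡⟨ cong (_+ pay c s n) (+-comm c d) ⟩
  d + c + pay c s n     ≡⟨ +-assoc d c _ ⟩
  d + (c + pay c s n)   ∎
  where open ≡-Reasoning

pay-mono : ∀ c s {m n} → m ≤ n → pay c s m ≤ pay c s n
pay-mono c []      m≤n = m≤n
pay-mono c (_ ∷ s) m≤n = +-monoʳ-≤ c (pay-mono c s m≤n)

≤-pay : ∀ c s {n} → n ≤ pay c s n
≤-pay c []      = ≤-refl
≤-pay c (_ ∷ s) = ≤-trans (≤-pay c s) (m≤n+m _ c)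

-- Covers the work caused by one input bit, including the way back of the head on W.
credit : ℕ
credit = 20

Fails : Prog → Store → ℕ → ℕ → Set
Fails p σ n n′ = ∃[ σ′ ] Run p σ n nothing σ′ n′

retain : ∀ k {r σ n} → Run (ret r) σ (suc (k + n)) r σ n
retain k = ret ⦃ m≤n+m _ k ⦄

rewind : Prog
rewind = loop (on W back >>= maybe′ (λ _ → ret (just true)) (ret (just false)))

rewind-run : ∀ {F} → Lens W F → ∀ u v {s n} →
             Run rewind (F (u , v) , s) (3 + pay 3 u n) (just false) (F ([] , u ʳ++ v) , s) n
rewind-run L []      v = leave (on back L >>= ret) λ()
rewind-run L (b ∷ u) v = again (on back L >>= retain 0) (rewind-run L u (b ∷ v))

descend : Prog
descend = loop (read >>? λ b → if b then (on W pop >>? λ _ → ret (just true)) else ret (just false))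

pick : Prog
pick = on W pop >>? λ b → rewind >>= λ _ → ret (just b)

wire : Prog
wire = descend >>? λ _ → pick

-- Of the 20 steps for a one in the code, 5 pay for the iteration and 3 are set aside for the way
-- back over the popped bit. The final zero keeps 17 after `read` and `ret`. The equation says that
-- the word on the tape is unchanged, so rewinding restores the stack.
descend-run : ∀ {F} → Lens W F → ∀ {m} (v : Vec Bool m) i u {s n} → ∃₂ λ u′ v′ →
              Run descend (F (u , toList v) , encodeWire i ++ s) (pay 3 u (pay credit (encodeWire i ++ s) n))
                  (just false) (F (u′ , lookup v i ∷ v′) , s) (17 + pay 3 u′ (pay credit s n)) ×
              u′ ʳ++ lookup v i ∷ v′ ≡ u ʳ++ toList v
descend-run L (b ∷ v) zero u =
  u , toList v ,
  waste (≤-reflexive (sym (pay-+ 3 u credit _))) (leave (read >>= retain 0) λ()) , refl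
descend-run L (b ∷ v) (suc i) u =
  let u′ , v′ , ρ , eq = descend-run L v i (b ∷ u) in
  u′ , v′ , waste (≤-reflexive (sym (pay-+ 3 u credit _)))
    (again (read >>= (on pop L >>= retain 12)) ρ) , eq

-- The 17 steps left by `descend` pay for `pop` (2), for the step of `rewind` over the bit just
-- looked up and for its end (3 + 3), and for `ret` (1). The remaining 8 are for the caller's use of
-- the bit.
wire-run : ∀ {F} → Lens W F → ∀ {m} (v : Vec Bool m) i {s} n →
           Run wire (F ([] , toList v) , encodeWire i ++ s) (pay credit (encodeWire i ++ s) n)
               (just (lookup v i)) (F ([] , toList v) , s) (8 + pay credit s n)
wire-run {F} L v i {s} n =
  let u , v′ , ρ , eq = descend-run L v i [] in
  ρ >>= (on pop L >>= (waste (enough u)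
    (subst (λ v″ → Run rewind (F (lookup v i ∷ u , v′) , s)
                        (6 + pay 3 u (9 + pay credit s n)) (just false)
                        (F ([] , v″) , s) (9 + pay credit s n)) eq
      (rewind-run L (lookup v i ∷ u) v′)) >>= retain 0))
  where
  enough : ∀ u → 6 + pay 3 u (9 + pay credit s n) ≤ 15 + pay 3 u (pay credit s n)
  enough u rewrite pay-+ 3 u 9 (pay credit s n) = ≤-refl

-- An index beyond the stack size makes `descend` fail on a one, but an index equal to the size is
-- noticed only by `pick`; hence the failure is stated for `descend` and its continuation together.
descend-total : ∀ {F} → Lens W F → ∀ {m} (v : Vec Bool m) u s {n} →
                (∃₂ λ (i : Fin m) s′ → s ≡ encodeWire i ++ s′) ⊎
                (∃₂ λ r σ′ → Run descend (F (u , toList v) , s) (pay credit s (8 + n)) r σ′ (5 + n) ×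
                             Fails (maybe′ (λ _ → pick) (ret nothing) r) σ′ (5 + n) n)
descend-total L v       u []          = inj₂ (_ , _ , leave (read >>= retain 0) (λ()) , _ , ret)
descend-total L []      u (true ∷ s)  =
  inj₂ (_ , _ , waste (+-monoʳ-≤ credit (≤-pay credit s))
                  (leave (read >>= (on pop L >>= retain 18)) (λ())) , _ , ret)
descend-total L []      u (false ∷ s) =
  inj₂ (_ , _ , waste (+-monoʳ-≤ credit (≤-pay credit s)) (leave (read >>= retain 20) (λ())) ,
        _ , (on pop L >>= ret))
descend-total L (b ∷ v) u (false ∷ s) = inj₁ (zero , s , refl)
descend-total L (b ∷ v) u (true ∷ s) with descend-total L v (b ∷ u) s
... | inj₁ (i , s′ , refl)  = inj₁ (suc i , s′ , refl)
... | inj₂ (r , σ′ , ρ , f) = inj₂ (r , σ′ , again (read >>= (on pop L >>= ret)) ρ , f)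

wire-total : ∀ {F} → Lens W F → ∀ {m} (v : Vec Bool m) s {n} →
             (∃₂ λ (i : Fin m) s′ → s ≡ encodeWire i ++ s′) ⊎
             Fails wire (F ([] , toList v) , s) (pay credit s (8 + n)) n
wire-total L v s = Sum.map₂ (λ { (_ , _ , ρ , (σ , ρ′)) → σ , (ρ >>= ρ′) }) (descend-total L v [] s)

pushBit : Bool → Prog
pushBit b = on W (push b) >>= λ _ → ret (just true)

binaryGate : Bool → Bool → Bool → Bool
binaryGate b p q = if b then p ∨ q else p ∧ q

gate : Prog
gate = read >>? λ a → read >>? λ b →
  if a then (wire >>? λ p → wire >>? λ q → pushBit (binaryGate b p q))
  else if b then (wire >>? λ p → pushBit (not p))
  else (read >>? pushBit)

surplus : ∀ k {p σ n r σ′ n′} → Run p σ n r σ′ n′ → Run p σ (k + n) r σ′ n′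
surplus k = waste (m≤n+m _ k)

gate-run : ∀ {F} → Lens W F → ∀ {m} (v : Vec Bool m) g {s} n →
           Run gate (F ([] , toList v) , encodeGate g ++ s) (pay credit (encodeGate g ++ s) n)
               (just true) (F ([] , toList (evalGate g v ∷ v)) , s) (pay credit s n)
gate-run L v (const b) n = read >>= (read >>= (read >>= (on (push b) L >>= ret)))
gate-run L v (neg i) n =
  -- The two opcode bits bring in 40 steps, of which the two `read`s use 4.
  read >>= (read >>= (surplus 36 (wire-run L v i n) >>= (on (push _) L >>= ret)))
gate-run L v (and i j) {s} n rewrite ++-assoc (encodeWire i) (encodeWire j) s =
  read >>= (read >>= (surplus 36 (wire-run L v i n) >>=
    (surplus 8 (wire-run L v j n) >>= (on (push _) L >>= ret))))
gate-run L v (or i j) {s} n rewrite ++-assoc (encodeWire i) (encodeWire j) s =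
  read >>= (read >>= (surplus 36 (wire-run L v i n) >>=
    (surplus 8 (wire-run L v j n) >>= (on (push _) L >>= ret))))

abort : ∀ {p f σ n n′} → Fails p σ n (suc n′) → Fails (p >>? f) σ n n′
abort (σ′ , ρ) = σ′ , (ρ >>= ret)

infixr 1 _then_

_then_ : ∀ {p f σ n r σ′ n′ n″} → Run p σ n r σ′ n′ → Fails (f r) σ′ n′ n″ → Fails (p >>= f) σ n n″
ρ then (σ″ , ρ′) = σ″ , (ρ >>= ρ′)

excess : ∀ k {p σ n n′} → Fails p σ n n′ → Fails p σ (k + n) n′
excess k (σ′ , ρ) = σ′ , surplus k ρ

stop : ∀ {σ n n′} → ⦃ n′ ≤ n ⦄ → Fails (ret nothing) σ (suc n) n′
stop = _ , ret

gate-total : ∀ {F} → Lens W F → ∀ {m} (v : Vec Bool m) s {n} →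
             (∃₂ λ (g : Gate m) s′ → s ≡ encodeGate g ++ s′) ⊎
             Fails gate (F ([] , toList v) , s) (pay credit s (9 + n)) n
gate-total L v [] = inj₂ (read then stop)
gate-total L v (b ∷ []) = inj₂ (read then read then stop)
gate-total L v (false ∷ false ∷ []) = inj₂ (read then read then read then stop)
gate-total L v (false ∷ false ∷ b ∷ s) = inj₁ (const b , s , refl)
gate-total L v (false ∷ true ∷ s) {n} with wire-total L v s {suc n}
... | inj₁ (i , s′ , refl) = inj₁ (neg i , s′ , refl)
... | inj₂ f               = inj₂ (read then read then abort (excess 36 f))
gate-total L v (true ∷ b ∷ s) {n} with wire-total L v s {suc n}
... | inj₂ f = inj₂ (read then read then abort (excess 36 f))
... | inj₁ (i , s′ , refl) with wire-total L v s′ {suc n}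
...   | inj₂ f = inj₂ (read then read then surplus 36 (wire-run L v i (9 + n)) then abort (excess 8 f))
gate-total L v (true ∷ false ∷ s) | inj₁ (i , _ , refl) | inj₁ (j , s′ , refl) =
  inj₁ (and i j , s′ , cong (λ t → true ∷ false ∷ t) (sym (++-assoc (encodeWire i) (encodeWire j) s′)))
gate-total L v (true ∷ true ∷ s)  | inj₁ (i , _ , refl) | inj₁ (j , s′ , refl) =
  inj₁ (or i j , s′ , cong (λ t → true ∷ true ∷ t) (sym (++-assoc (encodeWire i) (encodeWire j) s′)))

gates : Prog
gates = loop (read >>? λ b → if b then gate else ret (just false))

encodeWires : ∀ {m o} → Vec (Fin m) o → Word → Word
encodeWires []       s = s
encodeWires (i ∷ is) s = encodeWire i ++ encodeWires is s

encodeWires-concat : ∀ {m o} (is : Vec (Fin m) o) s →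
                     List.concat (List.map encodeWire (toList is)) ++ s ≡ encodeWires is s
encodeWires-concat []       s = refl
encodeWires-concat (i ∷ is) s =
  trans (++-assoc (encodeWire i) _ s) (cong (encodeWire i ++_) (encodeWires-concat is s))

-- The output wires stay unread because the two circuits treat them differently: those of `C` are
-- collected on K, those of `V` compared with X and Y.
gates-run : ∀ {F} → Lens W F → ∀ {m o} (v : Vec Bool m) (c : Circuit m o) s n →
            ∃ λ k → ∃₂ λ (v′ : Vec Bool k) (is : Vec (Fin k) o) →
            Run gates (F ([] , toList v) , encodeCircuit c ++ s) (pay credit (encodeCircuit c ++ s) n)
                (just false) (F ([] , toList v′) , encodeWires is s) (pay credit (encodeWires is s) n) ×
            eval c v ≡ Vec.map (lookup v′) is
gates-run L v (outputs is) s n rewrite encodeWires-concat is s =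
  _ , v , is , leave (read >>= ret) (λ()) , refl
gates-run L v (g ▹ c) s n rewrite ++-assoc (encodeGate g) (encodeCircuit c) s =
  let k , v′ , is , ρ , eq = gates-run L (evalGate g v ∷ v) c s n in
  k , v′ , is , again (read >>= surplus 18 (gate-run L v g n)) ρ , eq

-- The recursion is on a bound `k` for the length, since the tail behind a gate is not a structural
-- subterm of `s`. Well-formed gates yield a circuit only once a later stage has parsed the output
-- wires, and that stage also chooses the budget `n` of the run.
gates-total : ∀ {F} → Lens W F → ∀ {m} (v : Vec Bool m) k s {n} → length s ≤ k →
              (∃ λ m′ → ∃₂ λ (v′ : Vec Bool m′) s′ →
                (∀ n → Run gates (F ([] , toList v) , s) (pay credit s n)
                           (just false) (F ([] , toList v′) , s′) (pay credit s′ n)) ×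
                (∀ {o} (is : Vec (Fin m′) o) {s″} → s′ ≡ encodeWires is s″ →
                  ∃ λ (c : Circuit m o) → s ≡ encodeCircuit c ++ s″)) ⊎
              Fails gates (F ([] , toList v) , s) (pay credit s (9 + n)) n
gates-total L v k [] _ = inj₂ (_ , leave (read >>= ret) (λ()))
gates-total L v (suc k) (false ∷ s) _ =
  inj₁ (_ , v , s , (λ n → leave (read >>= ret) (λ())) ,
    λ { is refl → outputs is , cong (false ∷_) (sym (encodeWires-concat is _)) })
gates-total L v (suc k) (true ∷ s) {n} (s≤s ≤k) with gate-total L v s
... | inj₂ (_ , ρ) = inj₂ (_ , leave (read >>= surplus 18 ρ) (λ()))
... | inj₁ (g , s′ , refl)
  with gates-total L (evalGate g v ∷ v) k s′ {n} (≤-trans (length-++-≤ʳ s′ {encodeGate g}) ≤k)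
...   | inj₂ (_ , ρ) = inj₂ (_ , again (read >>= surplus 18 (gate-run L v g (9 + n))) ρ)
...   | inj₁ (m′ , v′ , s″ , ρ , parse) =
  inj₁ (m′ , v′ , s″ , (λ n → again (read >>= surplus 18 (gate-run L v g n)) (ρ n)) ,
    λ is eq → let c , eq′ = parse is eq in
      g ▹ c , cong (true ∷_) (trans (cong (encodeGate g ++_) eq′) (sym (++-assoc (encodeGate g) _ _))))

record Slots (i : Register) (F : Zipper → Zipper → Vec Zipper 4) : Set where
  field
    input : ∀ w → Lens i (λ z → F z w)
    stack : ∀ z → Lens W (F z)

-- Returns `just false` if the register has the length given in unary by the input,
-- `nothing` if the input ends together with the register and `just true` otherwise.
sized : Register → Prog
sized i =
  loop (on i pop >>? λ _ → read >>= maybe′ (λ b → ret (just b)) (ret (just false)))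
    >>= maybe′ (λ _ → ret (just true)) read

-- On an unterminated header of ones, exactly the registers of the same length give `nothing`. Were
-- this `just true`, such a header would be accepted together with every x₂.
sizeTest : Word → Word → Result
sizeTest []      s          = List.head s
sizeTest (_ ∷ z) []         = just true
sizeTest (_ ∷ z) (false ∷ s) = just true
sizeTest (_ ∷ z) (true ∷ s) = sizeTest z s

sized-match : ∀ {i F} → Lens i F → ∀ u z {k s n} → length z ≡ k →
              Run (sized i) (F (u , z) , unary k ++ s) (pay 5 z (5 + n))
                  (just false) (F (z ʳ++ u , []) , s) n
sized-match {i} {F} L u z {s = s} {n} refl = let ρ = body u z in ρ >>= read
  where
  body : ∀ u z → Run (loop _) (F (u , z) , unary (length z) ++ s) (pay 5 z (5 + n))
                     nothing (F (z ʳ++ u , []) , false ∷ s) (2 + n)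
  body u []      = leave (on pop L >>= retain 0) (λ())
  body u (b ∷ z) = again (on pop L >>= (read >>= ret)) (body (b ∷ u) z)

-- Meant for the outcomes after which the verifier stops, so the final store is left open; after a
-- match it goes on, and `sized-match` supplies the exact store.
sized-run : ∀ {i F} → Lens i F → ∀ u z s {n} → ∃[ σ ]
            Run (sized i) (F (u , z) , s) (pay 5 z (5 + n)) (sizeTest z s) σ n
sized-run {i} {F} L u z s {n} with body u z s
  where
  body : ∀ u z s → ∃[ r ] ∃[ σ ] ∃[ σ′ ]
         Run (loop (on i pop >>? λ _ → read >>= maybe′ (λ b → ret (just b)) (ret (just false))))
             (F (u , z) , s) (pay 5 z (5 + n)) r σ (2 + n) ×
         Run (maybe′ (λ _ → ret (just true)) read r) σ (2 + n) (sizeTest z s) σ′ n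
  body u []      s           = _ , _ , _ , leave (on pop L >>= retain 0) (λ()) , read
  body u (b ∷ z) []          =
    _ , _ , _ , waste (+-monoʳ-≤ 5 (≤-pay 5 z)) (leave (on pop L >>= (read >>= retain 3)) (λ())) , ret
  body u (b ∷ z) (false ∷ s) =
    _ , _ , _ , waste (+-monoʳ-≤ 5 (≤-pay 5 z)) (leave (on pop L >>= (read >>= retain 3)) (λ())) , ret
  body u (b ∷ z) (true ∷ s)  =
    let r , σ , σ′ , ρ , ρ′ = body (b ∷ u) z s in
    r , σ , σ′ , again (on pop L >>= (read >>= ret)) ρ , ρ′
... | _ , _ , σ′ , ρ , ρ′ = σ′ , (ρ >>= ρ′)

sizeTest-unary : ∀ z {s} → sizeTest z s ≡ just false → ∃[ s′ ] s ≡ unary (length z) ++ s′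
sizeTest-unary []      {false ∷ s} refl = s , refl
sizeTest-unary (_ ∷ z) {true ∷ s}  eq   = let s′ , eq′ = sizeTest-unary z eq in s′ , cong (true ∷_) eq′

sizeTest-≡ : ∀ z k {s} → sizeTest z (unary k ++ s) ≡ just false → length z ≡ k
sizeTest-≡ []      zero    eq = refl
sizeTest-≡ (_ ∷ z) (suc k) eq = cong suc (sizeTest-≡ z k eq)

sizeTest-≢ : ∀ z k {s} → length z ≢ k → sizeTest z (unary k ++ s) ≡ just true
sizeTest-≢ []      zero    neq with () ← neq refl
sizeTest-≢ []      (suc k) neq = refl
sizeTest-≢ (_ ∷ z) zero    neq = refl
sizeTest-≢ (_ ∷ z) (suc k) neq = sizeTest-≢ z k (λ eq → neq (cong suc eq))

-- Bits are pushed in the order in which they are met, so `back` puts the word on W in its original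
-- order and `pop` puts it there reversed.
drain : Register → Op → Prog
drain i op = loop (on i op >>? λ b → on W (push b) >>= λ _ → ret (just true))

drain-back : ∀ {i F} → Slots i F → ∀ u v w {s n} →
             Run (drain i back) (F (u , v) ([] , w) , s) (pay 5 u (3 + n))
                 nothing (F ([] , u ʳ++ v) ([] , u ʳ++ w) , s) n
drain-back S []      v w = leave (on back (Slots.input S _) >>= ret) (λ())
drain-back S (b ∷ u) v w =
  again (on back (Slots.input S _) >>= (on (push b) (Slots.stack S _) >>= ret))
    (drain-back S u (b ∷ v) (b ∷ w))

drain-pop : ∀ {i F} → Slots i F → ∀ u v w {s n} →
            Run (drain i pop) (F (u , v) ([] , w) , s) (pay 5 v (3 + n))
                nothing (F (v ʳ++ u , []) ([] , v ʳ++ w) , s) n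
drain-pop S u []      w = leave (on pop (Slots.input S _) >>= ret) (λ())
drain-pop S u (b ∷ v) w =
  again (on pop (Slots.input S _) >>= (on (push b) (Slots.stack S _) >>= ret))
    (drain-pop S (b ∷ u) v (b ∷ w))

sameBit : Bool → Bool → Prog
sameBit false false = ret (just true)
sameBit true  true  = ret (just true)
sameBit _     _     = ret nothing

sameBit-≡ : ∀ b {σ n} k → Run (sameBit b b) σ (suc (k + n)) (just true) σ n
sameBit-≡ false k = retain k
sameBit-≡ true  k = retain k

sameBit-≢ : ∀ {b c σ n n′} → b ≢ c → n′ ≤ n → Run (sameBit b c) σ (suc n) nothing σ n′
sameBit-≢ {false} {false} neq _ with () ← neq refl
sameBit-≢ {false} {true}  _ ≤n = ret ⦃ ≤n ⦄
sameBit-≢ {true}  {false} _ ≤n = ret ⦃ ≤n ⦄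
sameBit-≢ {true}  {true}  neq _ with () ← neq refl

check : Register → Prog
check i = loop (on i pop >>= maybe′ (λ b → wire >>? λ c → sameBit c b) (ret (just false)))

check-run : ∀ {i F} → Slots i F →
            ∀ {m o} (v : Vec Bool m) (is : Vec (Fin m) o) u (z : Vec Bool o) {s} n →
            (Vec.map (lookup v) is ≡ z ×
             Run (check i) (F (u , toList z) ([] , toList v) , encodeWires is s)
                 (3 + pay credit (encodeWires is s) n)
                 (just false) (F (toList z ʳ++ u , []) ([] , toList v) , s) (pay credit s n)) ⊎
            (Vec.map (lookup v) is ≢ z ×
             Fails (check i) (F (u , toList z) ([] , toList v) , encodeWires is s)
               (3 + pay credit (encodeWires is s) n) n)
check-run S v [] u [] n = inj₁ (refl , leave (on pop (Slots.input S _) >>= ret) (λ()))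
check-run S v (i ∷ is) u (b ∷ z) {s} n with lookup v i Bool.≟ b
... | no neq = inj₂ ((λ eq → neq (cong Vec.head eq)) , _ ,
  leave (on pop (Slots.input S _) >>= (surplus 1 (wire-run (Slots.stack S _) v i n) >>=
    sameBit-≢ neq (≤-trans (≤-pay credit (encodeWires is s)) (m≤n+m _ 7)))) (λ()))
... | yes refl with check-run S v is (b ∷ u) z n
...   | inj₁ (eq , ρ) = inj₁ (cong (b ∷_) eq ,
  again (on pop (Slots.input S _) >>=
    (surplus 1 (wire-run (Slots.stack S _) v i n) >>= sameBit-≡ b 4)) ρ)
...   | inj₂ (neq , σ , ρ) = inj₂ ((λ eq → neq (cong Vec.tail eq)) , σ ,
  again (on pop (Slots.input S _) >>=
    (surplus 1 (wire-run (Slots.stack S _) v i n) >>= sameBit-≡ b 4)) ρ)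

-- The alternatives overlap: a wrong bit ends the check before the remaining wires are seen, so
-- `Fails` may also be returned on well-formed input.
check-total : ∀ {i F} → Slots i F → ∀ {m o} (v : Vec Bool m) u (z : Vec Bool o) s {n} →
              (∃₂ λ (is : Vec (Fin m) o) s′ → s ≡ encodeWires is s′) ⊎
              Fails (check i) (F (u , toList z) ([] , toList v) , s) (3 + pay credit s (9 + n)) n
check-total S v u []      s = inj₁ ([] , s , refl)
check-total S v u (b ∷ z) s {n} with wire-total (Slots.stack S (b ∷ u , toList z)) v s {suc n}
... | inj₂ (_ , ρ) = inj₂ (_ , leave (on pop (Slots.input S _) >>= (surplus 1 ρ >>= ret)) (λ()))
... | inj₁ (i , s′ , refl) with lookup v i Bool.≟ b
...   | no neq = inj₂ (_ ,
  leave (on pop (Slots.input S _) >>= (surplus 1 (wire-run (Slots.stack S _) v i (9 + n)) >>=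
    sameBit-≢ neq (≤-trans (m≤n+m n 9) (≤-trans (≤-pay credit s′) (m≤n+m _ 7))))) (λ()))
...   | yes refl with check-total S v (b ∷ u) z s′ {n}
...     | inj₁ (is , s″ , refl) = inj₁ (i ∷ is , s″ , refl)
...     | inj₂ (σ , ρ) = inj₂ (σ ,
  again (on pop (Slots.input S _) >>=
    (surplus 1 (wire-run (Slots.stack S _) v i (9 + n)) >>= sameBit-≡ b 4)) ρ)

atY : ∀ {x w k} → Lens Y (λ y → x ∷ y ∷ w ∷ k ∷ [])
atY = lens (λ _ → refl) (λ _ _ → refl)

atW : ∀ {x y k} → Lens W (λ w → x ∷ y ∷ w ∷ k ∷ [])
atW = lens (λ _ → refl) (λ _ _ → refl)

atK : ∀ {x y w} → Lens K (λ k → x ∷ y ∷ w ∷ k ∷ [])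
atK = lens (λ _ → refl) (λ _ _ → refl)

-- Y serves as the counter for the 1 + m outputs, which end up on K in reverse.
outs : Prog
outs = loop (wire >>? λ b → on K (push b) >>= λ _ →
             on Y pop >>= maybe′ (λ _ → ret (just true)) (ret (just false)))

outs-run : ∀ {x m o} (v : Vec Bool m) (is : Vec (Fin m) (suc o)) u (y : Vec Bool o) {s k} n →
           Run outs (x ∷ (u , toList y) ∷ ([] , toList v) ∷ ([] , k) ∷ [] , encodeWires is s)
                    (pay credit (encodeWires is s) n) (just false)
                    (x ∷ (toList y ʳ++ u , []) ∷ ([] , toList v) ∷
                      ([] , toList (Vec.map (lookup v) is) ʳ++ k) ∷ [] , s)
                    (pay credit s n)
outs-run v (i ∷ []) u [] n =
  leave (wire-run atW v i n >>= (on (push _) atK >>= (on pop atY >>= ret))) (λ())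
outs-run v (i ∷ is@(_ ∷ _)) u (b ∷ y) n =
  again (wire-run atW v i n >>= (on (push _) atK >>= (on pop atY >>= ret))) (outs-run v is (b ∷ u) y n)

outs-total : ∀ {x m o} (v : Vec Bool m) u (y : Vec Bool o) s {k n} →
             (∃₂ λ (is : Vec (Fin m) (suc o)) s′ → s ≡ encodeWires is s′) ⊎
             Fails outs (x ∷ (u , toList y) ∷ ([] , toList v) ∷ ([] , k) ∷ [] , s)
               (pay credit s (9 + n)) n
outs-total v u y s {n = n} with wire-total atW v s {suc n}
... | inj₂ (_ , ρ) = inj₂ (_ , leave (ρ >>= ret) (λ()))
outs-total v u []      _ | inj₁ (i , s , refl) = inj₁ (i ∷ [] , s , refl)
outs-total v u (b ∷ y) _ {n = n} | inj₁ (i , s , refl) with outs-total v (b ∷ u) y s {n = n}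
... | inj₁ (is , s′ , refl) = inj₁ (i ∷ is , s′ , refl)
... | inj₂ (_ , ρ) = inj₂ (_ ,
  again (wire-run atW v i (9 + n) >>= (on (push _) atK >>= (on pop atY >>= ret))) ρ)

-- Comparison of binary numbers

strip : Prog
strip = loop (on K back >>? λ b → ret (just (not b)))

longer : Prog
longer = loop (read >>= maybe′ (λ _ → on K back >>? λ _ → ret (just true)) (ret (just false)))

digit : Bool → Bool → Prog
digit false true  = ret (just false)
digit true  false = ret nothing
digit _     _     = ret (just true)

-- Up to the first difference the two numbers agree; from then on only their lengths matter.
-- If s has the one there, c needs an additional digit.
digits : Prog
digits = loop (read >>= maybe′ (λ a → on K back >>? digit a) (ret (just false)))
           >>= maybe′ (λ _ → longer) (on K back >>? λ _ → longer)

compare : Prog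
compare = strip >>? λ _ → read >>? λ a → if a then digits else ret nothing

atLeast : Word → Word → Bool
atLeast c       []      = true
atLeast []      (_ ∷ s) = false
atLeast (_ ∷ c) (_ ∷ s) = atLeast c s

digitsTest : Word → Word → Bool
digitsTest c           []          = true
digitsTest []          (_ ∷ s)     = false
digitsTest (true ∷ c)  (true ∷ s)  = digitsTest c s
digitsTest (false ∷ c) (false ∷ s) = digitsTest c s
digitsTest (true ∷ c)  (false ∷ s) = atLeast c s
digitsTest (false ∷ c) (true ∷ s)  = atLeast c (true ∷ s)

-- The word s has to start with a one, so that, once the zeros at the front of c are dropped,
-- the longer number is greater.
test : Word → Word → Bool
test []          s          = false
test (false ∷ c) s          = test c s
test (true ∷ c)  (true ∷ s) = digitsTest c s
test (true ∷ c)  _          = false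

-- A loop cannot exit with `just true`, so `just false` is the normal exit and stands for success.
verdict : Bool → Result
verdict true  = just false
verdict false = nothing

longer-run : ∀ {F} → Lens K F → ∀ c v s {n} → ∃[ σ ]
             Run longer (F (c , v) , s) (pay credit s (5 + n)) (verdict (atLeast c s)) σ n
longer-run L c       v []      = _ , leave (read >>= ret) (λ())
longer-run L []      v (_ ∷ s) = _ ,
  leave (read >>= (on back L >>=
    ret ⦃ ≤-trans (m≤n+m _ 5) (≤-trans (≤-pay credit s) (m≤n+m _ 15)) ⦄)) (λ())
longer-run L (b ∷ c) v (_ ∷ s) =
  let σ , ρ = longer-run L c (b ∷ v) s in σ , again (read >>= (on back L >>= ret)) ρ

digits-run : ∀ {F} → Lens K F → ∀ c v s {n} → ∃[ σ ]
             Run digits (F (c , v) , s) (pay credit s (10 + n)) (verdict (digitsTest c s)) σ n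
digits-run {F} L c v s {n} = let _ , _ , _ , σ , ρ , ρ′ = body c v s in σ , (ρ >>= ρ′)
  where
  enough : ∀ k s → pay credit s (5 + n) ≤ k + pay credit s (10 + n)
  enough k s = ≤-trans (pay-mono credit s (m≤n+m _ 5)) (m≤n+m _ k)

  body : ∀ c v s → ∃[ r ] ∃[ σ ] ∃[ n′ ] ∃[ σ′ ]
         Run (loop _) (F (c , v) , s) (pay credit s (10 + n)) r σ n′ ×
         Run (maybe′ (λ _ → longer) (on K back >>? λ _ → longer) r) σ n′ (verdict (digitsTest c s)) σ′ n
  body c           v []          =
    let σ , ρ = longer-run L c v [] in _ , _ , _ , σ , leave (read >>= retain 2) (λ()) , ρ
  body []          v (a ∷ s)     = _ , _ , 10 + n , _ ,
    waste (+-monoʳ-≤ credit (≤-pay credit s)) (leave (read >>= (on back L >>= retain 15)) (λ())) ,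
    (on back L >>= ret)
  body (true ∷ c)  v (true ∷ s)  =
    let _ , _ , _ , _ , ρ , ρ′ = body c (true ∷ v) s in
    _ , _ , _ , _ , again (read >>= (on back L >>= ret)) ρ , ρ′
  body (false ∷ c) v (false ∷ s) =
    let _ , _ , _ , _ , ρ , ρ′ = body c (false ∷ v) s in
    _ , _ , _ , _ , again (read >>= (on back L >>= ret)) ρ , ρ′
  body (true ∷ c)  v (false ∷ s) =
    let _ , ρ = longer-run L c (true ∷ v) s {n} in
    _ , _ , _ , _ , leave (read >>= (on back L >>= retain 0)) (λ()) , waste (enough 15 s) ρ
  body (false ∷ [])    v (true ∷ s)  =
    _ , _ , _ , _ , leave (read >>= (on back L >>= retain 0)) (λ()) ,
    (on back L >>= ret ⦃ ≤-trans (m≤n+m n 10) (≤-trans (≤-pay credit s) (m≤n+m _ 12)) ⦄)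
  body (false ∷ b ∷ c) v (true ∷ s)  =
    let _ , ρ = longer-run L c (b ∷ false ∷ v) s {n} in
    _ , _ , _ , _ , leave (read >>= (on back L >>= retain 0)) (λ()) ,
    (on back L >>= waste (enough 13 s) ρ)

-- `strip` reads no input and so earns no credit; its 3 steps per bit are charged to `c`.
compare-run : ∀ {F} → Lens K F → ∀ c v s {n} → ∃[ σ ]
              Run compare (F (c , v) , s) (pay 3 c (pay credit s (20 + n))) (verdict (test c s)) σ n
compare-run {F} L c v s {n} = let _ , _ , _ , σ , ρ , ρ′ = body c v s in σ , (ρ >>= ρ′)
  where
  body : ∀ c v s → ∃[ r ] ∃[ σ ] ∃[ n′ ] ∃[ σ′ ]
         Run strip (F (c , v) , s) (pay 3 c (pay credit s (20 + n))) r σ n′ ×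
         Run (maybe′ (λ _ → read >>? λ a → if a then digits else ret nothing) (ret nothing) r)
             σ n′ (verdict (test c s)) σ′ n
  body []          v s           = _ , _ , 1 + n , _ ,
    waste (≤-trans (m≤n+m (4 + n) 16) (≤-pay credit s)) (leave (on back L >>= retain 0) (λ())) , ret
  body (false ∷ c) v s           =
    let _ , _ , _ , _ , ρ , ρ′ = body c (false ∷ v) s in
    _ , _ , _ , _ , again (on back L >>= ret) ρ , ρ′
  body (true ∷ c)  v []          =
    _ , _ , _ , _ , leave (on back L >>= retain 0) (λ()) , waste (≤-pay 3 c) (read >>= retain 17)
  body (true ∷ c)  v (false ∷ s) =
    _ , _ , _ , _ , leave (on back L >>= retain 0) (λ()) ,
    waste (≤-trans (m≤n+m (3 + n) 37) (≤-trans (+-monoʳ-≤ credit (≤-pay credit s)) (≤-pay 3 c)))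
      (read >>= retain 0)
  body (true ∷ c)  v (true ∷ s)  =
    let _ , ρ = digits-run L c (true ∷ v) s {n} in
    _ , _ , _ , _ , leave (on back L >>= retain 0) (λ()) ,
    waste (≤-pay 3 c)
      (read >>= waste (≤-trans (pay-mono credit s (m≤n+m _ 10)) (m≤n+m _ 18)) ρ)

-- The verifier

pay-length : ∀ c s t {n} → length s ≡ length t → pay c s n ≡ pay c t n
pay-length c []      []      eq = refl
pay-length c (_ ∷ s) (_ ∷ t) eq = cong (c +_) (pay-length c s t (suc-injective eq))

pay-swap : ∀ c s d t n → pay c s (pay d t n) ≡ pay d t (pay c s n)
pay-swap c s d []      n = refl
pay-swap c s d (_ ∷ t) n = trans (pay-+ c s d _) (cong (d +_) (pay-swap c s d t n))

inX : ∀ {y k} → Slots X (λ x w → x ∷ y ∷ w ∷ k ∷ [])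
inX = record { input = λ _ → lens (λ _ → refl) (λ _ _ → refl)
             ; stack = λ _ → lens (λ _ → refl) (λ _ _ → refl) }

inY : ∀ {x k} → Slots Y (λ y w → x ∷ y ∷ w ∷ k ∷ [])
inY = record { input = λ _ → lens (λ _ → refl) (λ _ _ → refl)
             ; stack = λ _ → lens (λ _ → refl) (λ _ _ → refl) }

inK : ∀ {x y} → Slots K (λ k w → x ∷ y ∷ w ∷ k ∷ [])
inK = record { input = λ _ → lens (λ _ → refl) (λ _ _ → refl)
             ; stack = λ _ → lens (λ _ → refl) (λ _ _ → refl) }

length-reverse : ∀ (z : Word) → length (z ʳ++ []) ≡ length z
length-reverse z = trans (length-ʳ++ z) (+-identityʳ _)

restore : ∀ {i F} → Slots i F → ∀ z w {s n} →
          Run (drain i back) (F (z ʳ++ [] , []) ([] , w) , s) (pay 5 z (3 + n))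
              nothing (F ([] , z) ([] , z ++ w) , s) n
restore {i} {F} S z w {s} {n} =
  subst₂ (λ m z′ → Run (drain i back) (F (z ʳ++ [] , []) ([] , w) , s) m
                       nothing (F ([] , z′) ([] , z ++ w) , s) n)
    (pay-length 5 (z ʳ++ []) z (length-reverse z)) (trans (ʳ++-ʳ++ z) (++-identityʳ z))
    (subst (λ w′ → Run (drain i back) (F (z ʳ++ [] , []) ([] , w) , s) (pay 5 (z ʳ++ []) (3 + n))
                       nothing (F ([] , (z ʳ++ []) ʳ++ []) ([] , w′) , s) n)
      (ʳ++-ʳ++ z) (drain-back S (z ʳ++ []) [] w))

transfer : ∀ {i F} → Slots i F → ∀ z {s n} →
           Run (drain i pop) (F ([] , z ʳ++ []) ([] , []) , s) (pay 5 z (3 + n))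
               nothing (F (z , []) ([] , z) , s) n
transfer {i} {F} S z {s} {n} =
  subst₂ (λ m z′ → Run (drain i pop) (F ([] , z ʳ++ []) ([] , []) , s) m
                       nothing (F (z′ , []) ([] , z′) , s) n)
    (pay-length 5 (z ʳ++ []) z (length-reverse z)) (trans (ʳ++-ʳ++ z) (++-identityʳ z))
    (drain-pop S [] (z ʳ++ []) [])

-- The second draining of Y only rewinds it: the gap cuts off all that W contains, to make
-- room for the outputs of C, which become the inputs of V.
setup certify : Prog
setup =
  drain Y back >>= λ _ → drain X back >>= λ _ → gates >>? λ _ → outs >>? λ _ →
  drain Y back >>= λ _ → on W gap >>= λ _ → drain K pop >>= λ _ → ret (just true)
certify = gates >>? λ _ → check X >>? λ _ → check Y >>? λ _ → compare >>? λ _ → ret (just true)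

sizedStore : Word → Word → Vec Zipper 4
sizedStore x y = (x ʳ++ [] , []) ∷ (y ʳ++ [] , []) ∷ ([] , []) ∷ ([] , []) ∷ []

-- W holds the inputs of `V`. On K the word `c` lies to the left of the head, nearest cell first, so
-- `back` will meet the most significant bit first.
imageStore : Word → Word → Word → Vec Zipper 4
imageStore x y c = ([] , x) ∷ ([] , y) ∷ ([] , c) ∷ (c , []) ∷ []

-- `false ∷ y` stands for any word of length m + 1, such as the output of `C`.
collectCost : Word → ℕ → ℕ
collectCost y n = pay 5 y (5 + pay 5 (false ∷ y) (4 + n))

loadCost : Word → Word → ℕ → ℕ
loadCost x y n = pay 5 y (3 + pay 5 x (3 + n))

≤-collectCost : ∀ k y {n} → n ≤ k + collectCost y n
≤-collectCost k y {n} = begin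
  n                                            ≤⟨ m≤n+m n 4 ⟩
  4 + n                                        ≤⟨ ≤-pay 5 (false ∷ y) ⟩
  pay 5 (false ∷ y) (4 + n)                    ≤⟨ m≤n+m _ 5 ⟩
  5 + pay 5 (false ∷ y) (4 + n)                ≤⟨ ≤-pay 5 y ⟩
  collectCost y n                              ≤⟨ m≤n+m _ k ⟩
  k + collectCost y n                          ∎
  where open ≤-Reasoning

pay-collectCost : ∀ c s y n → pay c s (collectCost y n) ≡ collectCost y (pay c s n)
pay-collectCost c s y n = begin
  pay c s (pay 5 y (5 + pay 5 (false ∷ y) (4 + n)))
    ≡⟨ pay-swap c s 5 y _ ⟩
  pay 5 y (pay c s (5 + pay 5 (false ∷ y) (4 + n)))
    ≡⟨ cong (pay 5 y) (trans (pay-+ c s 5 _) (cong (5 +_) (pay-swap c s 5 (false ∷ y) _))) ⟩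
  pay 5 y (5 + pay 5 (false ∷ y) (pay c s (4 + n)))
    ≡⟨ cong (λ k → pay 5 y (5 + pay 5 (false ∷ y) k)) (pay-+ c s 4 n) ⟩
  pay 5 y (5 + pay 5 (false ∷ y) (4 + pay c s n)) ∎
  where open ≡-Reasoning

module _ {n m} (x : Vec Bool n) (y : Vec Bool m) where

  private
    xs = toList x
    ys = toList y

  loaded : ∀ {p s k r σ′ k′} →
    Run p (([] , xs) ∷ ([] , ys) ∷ ([] , toList (x Vec.++ y)) ∷ ([] , []) ∷ [] , s) k r σ′ k′ →
    Run (drain Y back >>= λ _ → drain X back >>= λ _ → p) (sizedStore xs ys , s) (loadCost xs ys k) r σ′ k′
  -- As `y` goes on the stack before `x`, the wires form `x ++ y` from the top.
  loaded ρ = restore inY ys [] >>= (restore inX xs (ys ++ []) >>=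
    subst (λ w → Run _ (([] , xs) ∷ ([] , ys) ∷ ([] , w) ∷ ([] , []) ∷ [] , _) _ _ _ _)
      (trans (toList-++ x y) (cong (xs ++_) (sym (++-identityʳ ys)))) ρ)

  collected : ∀ {k} (v : Vec Bool k) (is : Vec (Fin k) (suc m)) {s} j →
    Run (outs >>? λ _ → drain Y back >>= λ _ → on W gap >>= λ _ → drain K pop >>= λ _ → ret (just true))
        (([] , xs) ∷ ([] , ys) ∷ ([] , toList v) ∷ ([] , []) ∷ [] , encodeWires is s)
        (pay credit (encodeWires is s) (collectCost ys j))
        (just true) (imageStore xs ys (toList (Vec.map (lookup v) is)) , s) (pay credit s j)
  collected v is {s} j =
    outs-run v is [] y (collectCost ys j) >>=
    (waste (≤-reflexive (sym (pay-collectCost credit s ys j))) (restore inY ys (toList v)) >>=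
    (on gap atW >>=
    (waste (≤-reflexive (pay-length 5 c (false ∷ ys) length-c))
      (transfer inK c) >>= ret)))
    where
    c = toList (Vec.map (lookup v) is)
    length-c : length c ≡ length (false ∷ ys)
    length-c = trans (length-toList (Vec.map (lookup v) is)) (cong suc (sym (length-toList y)))

  setupCost : Word → ℕ → ℕ
  setupCost s j = loadCost xs ys (pay credit s (collectCost ys j))

  setup-run : (C : Circuit (n + m) (suc m)) → ∀ s j →
              Run setup (sizedStore xs ys , encodeCircuit C ++ s) (setupCost (encodeCircuit C ++ s) j)
                  (just true) (imageStore xs ys (toList (eval C (x Vec.++ y))) , s) (pay credit s j)
  setup-run C s j with gates-run atW (x Vec.++ y) C s (collectCost ys j)
  ... | _ , v , is , ρ , eq = loaded (ρ >>=
    subst (λ c → Run _ _ _ _ (imageStore xs ys (toList c) , s) _) (sym eq) (collected v is j))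

  setup-total : ∀ s {j} →
                (∃₂ λ (C : Circuit (n + m) (suc m)) s′ → s ≡ encodeCircuit C ++ s′) ⊎
                Fails setup (sizedStore xs ys , s) (setupCost s (10 + j)) j
  setup-total s {j} with gates-total atW (x Vec.++ y) (length s) s {suc j} ≤-refl
  ... | inj₂ (_ , ρ) = inj₂ (_ , loaded (waste (pay-mono credit s (≤-collectCost 0 ys)) ρ >>= ret))
  ... | inj₁ (_ , v , s₁ , ρ , parse) with outs-total v [] y s₁ {n = suc j}
  ...   | inj₂ (_ , ρ′) = inj₂ (_ ,
    loaded (ρ (collectCost ys (10 + j)) >>=
      (waste (pay-mono credit s₁ (≤-collectCost 0 ys)) ρ′ >>= ret)))
  ...   | inj₁ (is , s₂ , eq) = let C , eq′ = parse is eq in inj₁ (C , s₂ , eq′)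

data Decides (P : Set) : Result → Set where
  accept : P → Decides P (just true)
  reject : ¬ P → Decides P nothing

encodeWires-++ : ∀ {k o o′} (is : Vec (Fin k) o) (js : Vec (Fin k) o′) s →
                 encodeWires (is Vec.++ js) s ≡ encodeWires is (encodeWires js s)
encodeWires-++ []       js s = refl
encodeWires-++ (i ∷ is) js s = cong (encodeWire i ++_) (encodeWires-++ is js s)

-- The ends of the two checks take 3 steps each, `strip` takes 3 per bit of `c`, and 21 is the 20 of
-- `compare-run` plus a final `ret`.
certifyCost : Word → Word → ℕ → ℕ
certifyCost c s j = pay credit s (6 + pay 3 c (21 + j))

module _ {n m o} (x : Vec Bool n) (y : Vec Bool m) (c : Vec Bool o) where

  private
    xs = toList x
    ys = toList y
    cs = toList c

    checkStore : Zipper → Zipper → Word → Vec Zipper 4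
    checkStore zx zy v = zx ∷ zy ∷ ([] , v) ∷ (cs , []) ∷ []

  compare-decides : ∀ {zx zy v} s j → ∃₂ λ r σ →
    Run (compare >>? λ _ → ret (just true))
        (checkStore zx zy v , s) (pay credit s (pay 3 cs (21 + j))) r σ j ×
    Decides (test cs s ≡ true) r
  compare-decides {zx} {zy} {v} s j
    with test cs s | compare-run (atK {zx} {zy} {[] , v}) cs [] s {suc j}
  ... | true  | σ , ρ =
    _ , _ , (waste (≤-reflexive (sym (pay-swap credit s 3 cs _))) ρ >>= ret) , accept refl
  ... | false | σ , ρ =
    _ , _ , (waste (≤-reflexive (sym (pay-swap credit s 3 cs _))) ρ >>= ret) , reject λ()

  pay-3+ : ∀ s {j} → 3 + pay credit s j ≤ pay credit s (3 + j)
  pay-3+ s = ≤-reflexive (sym (pay-+ credit s 3 _))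

  certify-run : (V : Circuit o (n + m)) → ∀ s j → ∃₂ λ r σ →
                Run certify (imageStore xs ys cs , encodeCircuit V ++ s)
                    (certifyCost cs (encodeCircuit V ++ s) j) r σ j ×
                Decides (eval V c ≡ x Vec.++ y × test cs s ≡ true) r
  certify-run V s j with gates-run (atW {[] , xs} {[] , ys} {cs , []}) c V s (6 + pay 3 cs (21 + j))
  ... | _ , v , is , ρ , eq with Vec.splitAt n is
  ...   | is₁ , is₂ , refl rewrite encodeWires-++ is₁ is₂ s | Vec.map-++ (lookup v) is₁ is₂ | eq
    with check-run inX v is₁ [] x {encodeWires is₂ s} (3 + pay 3 cs (21 + j))
  ...     | inj₂ (neq , _ , ρ₁) =
    _ , _ , (ρ >>= (waste (pay-3+ (encodeWires is₁ (encodeWires is₂ s))) ρ₁ >>=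
               ret ⦃ ≤-trans (m≤n+m j 23) (+-monoʳ-≤ 2 (≤-pay 3 cs)) ⦄)) ,
    reject λ (eq′ , _) → neq (++-injectiveˡ _ _ eq′)
  ...     | inj₁ (eq₁ , ρ₁) with check-run inY v is₂ [] y {s} (pay 3 cs (21 + j))
  ...       | inj₂ (neq , _ , ρ₂) =
    _ , _ , (ρ >>= (waste (pay-3+ (encodeWires is₁ (encodeWires is₂ s))) ρ₁ >>=
              (waste (pay-3+ (encodeWires is₂ s)) ρ₂ >>=
                waste (≤-pay 3 cs) (retain 20)))) ,
    reject λ (eq′ , _) → neq (++-injectiveʳ _ _ eq′)
  ...       | inj₁ (eq₂ , ρ₂) with compare-decides {xs ʳ++ [] , []} {ys ʳ++ [] , []} {toList v} s j
  ...         | _ , σ , ρ₃ , d =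
    _ , σ , (ρ >>= (waste (pay-3+ (encodeWires is₁ (encodeWires is₂ s))) ρ₁ >>=
              (waste (pay-3+ (encodeWires is₂ s)) ρ₂ >>= ρ₃))) , both d
    where
    both : ∀ {r} → Decides (test cs s ≡ true) r → Decides (_ × test cs s ≡ true) r
    both (accept t) = accept (cong₂ Vec._++_ eq₁ eq₂ , t)
    both (reject f) = reject λ (_ , t) → f t

  certify-total : ∀ s {j} → (∃₂ λ (V : Circuit o (n + m)) s′ → s ≡ encodeCircuit V ++ s′) ⊎
                  Fails certify (imageStore xs ys cs , s) (certifyCost cs s j) j
  certify-total s {j} with gates-total (atW {[] , xs} {[] , ys} {cs , []}) c (length s) s {suc j} ≤-refl
  ... | inj₂ (_ , ρ) = inj₂ (_ , (waste (pay-mono credit s enough) ρ >>= ret))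
    where
    enough : 10 + j ≤ 6 + pay 3 cs (21 + j)
    enough = ≤-trans (m≤n+m (10 + j) 11) (≤-trans (≤-pay 3 cs) (m≤n+m _ 6))
  ... | inj₁ (_ , v , s₁ , ρ , parse) with check-total inX v [] x s₁ {suc j}
  ...   | inj₂ (_ , ρ₁) =
    inj₂ (_ , (ρ (6 + pay 3 cs (21 + j)) >>=
      (waste (≤-trans (+-monoʳ-≤ 3 (pay-mono credit s₁ enough)) (pay-3+ s₁)) ρ₁ >>= ret)))
    where
    enough : 10 + j ≤ 3 + pay 3 cs (21 + j)
    enough = ≤-trans (m≤n+m (10 + j) 11) (≤-trans (≤-pay 3 cs) (m≤n+m _ 3))
  ...   | inj₁ (is₁ , s₂ , refl) with check-run inX v is₁ [] x {s₂} (3 + pay 3 cs (21 + j))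
  -- A mismatch with `x` rejects before the wires for `y` are parsed, so no `V` is claimed here.
  ...     | inj₂ (_ , _ , ρ₁) =
    inj₂ (_ , (ρ (6 + pay 3 cs (21 + j)) >>= (waste (pay-3+ (encodeWires is₁ s₂)) ρ₁ >>=
                 ret ⦃ ≤-trans (m≤n+m j 23) (+-monoʳ-≤ 2 (≤-pay 3 cs)) ⦄)))
  ...     | inj₁ (_ , ρ₁) with check-total inY v [] y s₂ {suc j}
  ...       | inj₁ (is₂ , s₃ , refl) =
    let V , eq = parse (is₁ Vec.++ is₂) (sym (encodeWires-++ is₁ is₂ s₃)) in inj₁ (V , s₃ , eq)
  ...       | inj₂ (_ , ρ₂) =
    inj₂ (_ , (ρ (6 + pay 3 cs (21 + j)) >>= (waste (pay-3+ (encodeWires is₁ s₂)) ρ₁ >>=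
      (waste (≤-trans (+-monoʳ-≤ 3 (pay-mono credit s₂ enough)) (pay-3+ s₂)) ρ₂ >>= ret))))
    where
    enough : 10 + j ≤ pay 3 cs (21 + j)
    enough = ≤-trans (m≤n+m (10 + j) 11) (≤-pay 3 cs)

judge : Prog
judge = setup >>? λ _ → certify

module _ {n m} (x : Vec Bool n) (y : Vec Bool m) where

  private
    xs = toList x
    ys = toList y

  judgeCost : Word → ℕ → ℕ
  judgeCost s j = setupCost x y s (10 + (6 + pay 3 (false ∷ ys) (21 + j)))

  private
    certifyCost-image : ∀ (c : Vec Bool (suc m)) s j →
                        certifyCost (toList c) s j ≤ pay credit s (10 + (6 + pay 3 (false ∷ ys) (21 + j)))
    certifyCost-image c s j =
      pay-mono credit s (≤-trans
        (+-monoʳ-≤ 6 (≤-reflexive (pay-length 3 (toList c) (false ∷ ys) length-c))) (m≤n+m _ 10))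
      where
      length-c : length (toList c) ≡ length (false ∷ ys)
      length-c = trans (length-toList c) (cong suc (sym (length-toList y)))

  judge-run : (C : Circuit (n + m) (suc m)) (V : Circuit (suc m) (n + m)) → ∀ s j → ∃₂ λ r σ →
              Run judge (sizedStore xs ys , encodeCircuit C ++ encodeCircuit V ++ s)
                  (judgeCost (encodeCircuit C ++ encodeCircuit V ++ s) j) r σ j ×
              Decides (eval V (eval C (x Vec.++ y)) ≡ x Vec.++ y ×
                       test (toList (eval C (x Vec.++ y))) s ≡ true) r
  judge-run C V s j with certify-run x y (eval C (x Vec.++ y)) V s j
  ... | r , σ , ρ , d =
    r , σ , (setup-run x y C (encodeCircuit V ++ s) (10 + (6 + pay 3 (false ∷ ys) (21 + j))) >>=
             waste (certifyCost-image (eval C (x Vec.++ y)) (encodeCircuit V ++ s) j) ρ) , d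

  judge-total : ∀ s {j} →
                (∃₂ λ (C : Circuit (n + m) (suc m)) (V : Circuit (suc m) (n + m)) → ∃[ s′ ]
                  s ≡ encodeCircuit C ++ encodeCircuit V ++ s′) ⊎
                Fails judge (sizedStore xs ys , s) (judgeCost s j) j
  judge-total s {j} with setup-total x y s {6 + pay 3 (false ∷ ys) (21 + j)}
  ... | inj₂ (_ , ρ) = inj₂ (_ , (ρ >>=
    ret ⦃ ≤-trans (m≤n+m j 5) (+-monoʳ-≤ 5 (≤-trans (m≤n+m j 21) (≤-pay 3 (false ∷ ys)))) ⦄))
  ... | inj₁ (C , s₁ , refl) with certify-total x y (eval C (x Vec.++ y)) s₁ {j}
  ...   | inj₁ (V , s₂ , refl) = inj₁ (C , V , s₂ , refl)
  ...   | inj₂ (_ , ρ) =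
    inj₂ (_ , (setup-run x y C s₁ (10 + (6 + pay 3 (false ∷ ys) (21 + j))) >>=
               waste (certifyCost-image (eval C (x Vec.++ y)) s₁ j) ρ))

afterX afterY : Result → Prog
afterY (just false) = judge
afterY r            = ret r
afterX (just false) = sized Y >>= afterY
afterX _            = ret nothing

verify : Prog
verify = sized X >>= afterX

-- Values of binary numbers

valueFrom : ℕ → Word → ℕ
valueFrom = foldl (λ a b → 2 * a + bitValue b)

valueFrom-≥ : ∀ a w → a * 2 ^ length w ≤ valueFrom a w
valueFrom-≥ a []      = ≤-reflexive (*-identityʳ a)
valueFrom-≥ a (b ∷ w) = begin
  a * (2 * 2 ^ length w)                  ≡⟨ lem a (2 ^ length w) ⟩
  2 * a * 2 ^ length w                    ≤⟨ *-monoˡ-≤ (2 ^ length w) (m≤m+n (2 * a) _) ⟩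
  (2 * a + bitValue b) * 2 ^ length w     ≤⟨ valueFrom-≥ (2 * a + bitValue b) w ⟩
  valueFrom (2 * a + bitValue b) w        ∎
  where
  open ≤-Reasoning
  lem : ∀ a k → a * (2 * k) ≡ 2 * a * k
  lem = solve-∀

bitValue≤1 : ∀ b → bitValue b ≤ 1
bitValue≤1 false = z≤n
bitValue≤1 true  = ≤-refl

valueFrom-< : ∀ a w → valueFrom a w < suc a * 2 ^ length w
valueFrom-< a []      = ≤-reflexive (sym (*-identityʳ (suc a)))
valueFrom-< a (b ∷ w) = begin-strict
  valueFrom (2 * a + bitValue b) w            <⟨ valueFrom-< (2 * a + bitValue b) w ⟩
  suc (2 * a + bitValue b) * 2 ^ length w
    ≤⟨ *-monoˡ-≤ (2 ^ length w) (s≤s (+-monoʳ-≤ (2 * a) (bitValue≤1 b))) ⟩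
  suc (2 * a + 1) * 2 ^ length w              ≡⟨ lem a (2 ^ length w) ⟩
  suc a * (2 * 2 ^ length w)                  ∎
  where
  open ≤-Reasoning
  lem : ∀ a k → suc (2 * a + 1) * k ≡ suc a * (2 * k)
  lem = solve-∀

valueFrom-<-lead : ∀ {a b} s c → a < b → length s ≤ length c → valueFrom a s < valueFrom b c
valueFrom-<-lead {a} {b} s c a<b ≤c = begin-strict
  valueFrom a s           <⟨ valueFrom-< a s ⟩
  suc a * 2 ^ length s    ≤⟨ *-mono-≤ a<b (^-monoʳ-≤ 2 ≤c) ⟩
  b * 2 ^ length c        ≤⟨ valueFrom-≥ b c ⟩
  valueFrom b c           ∎
  where open ≤-Reasoning

-- The additional digit of `c` at least doubles `b`, after which the lead decides.
valueFrom-<-length : ∀ {a b} s c → a < 2 * b → length s < length c → valueFrom a s < valueFrom b c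
valueFrom-<-length {a} {b} s c a<2b <c = begin-strict
  valueFrom a s               <⟨ valueFrom-< a s ⟩
  suc a * 2 ^ length s        ≤⟨ *-monoˡ-≤ (2 ^ length s) a<2b ⟩
  2 * b * 2 ^ length s        ≡⟨ lem b (2 ^ length s) ⟩
  b * 2 ^ suc (length s)      ≤⟨ *-monoʳ-≤ b (^-monoʳ-≤ 2 <c) ⟩
  b * 2 ^ length c            ≤⟨ valueFrom-≥ b c ⟩
  valueFrom b c               ∎
  where
  open ≤-Reasoning
  lem : ∀ b k → 2 * b * k ≡ b * (2 * k)
  lem = solve-∀

atLeast-reflects : ∀ c s → Reflects (length s ≤ length c) (atLeast c s)
atLeast-reflects c       []      = ofʸ z≤n
atLeast-reflects []      (_ ∷ s) = ofⁿ λ()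
atLeast-reflects (_ ∷ c) (_ ∷ s) with atLeast c s | atLeast-reflects c s
... | true  | ofʸ ≤c = ofʸ (s≤s ≤c)
... | false | ofⁿ ≰c = ofⁿ λ ≤c → ≰c (s≤s⁻¹ ≤c)

-- The side condition of `valueFrom-<-length` when the shorter number has the one at the first
-- difference. It needs a positive common prefix.
odd<twice-even : ∀ a → 2 * suc a + 1 < 2 * (2 * suc a + 0)
odd<twice-even a = subst (2 * suc a + 1 <_) (sym (lem a)) (m≤m+n (suc (2 * suc a + 1)) (2 * a))
  where
  lem : ∀ a → 2 * (2 * suc a + 0) ≡ suc (2 * suc a + 1) + 2 * a
  lem = solve-∀

-- The common prefix has value `suc a`; it must be positive for the longer number to be greater.
-- Appending `b` turns it into `suc (a + suc (a + 0) + bitValue b)` by computation, so the recursive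
-- calls need no transport.
digitsTest-reflects : ∀ a c s →
                      Reflects (valueFrom (suc a) s ≤ valueFrom (suc a) c) (digitsTest c s)
digitsTest-reflects a []          []          = ofʸ ≤-refl
digitsTest-reflects a c@(_ ∷ _)   []          =
  ofʸ (<⇒≤ (valueFrom-<-length {suc a} {suc a} [] c (m<m+n (suc a) (s≤s z≤n)) (s≤s z≤n)))
digitsTest-reflects a []          s@(_ ∷ _)   =
  ofⁿ (<⇒≱ (valueFrom-<-length {suc a} {suc a} [] s (m<m+n (suc a) (s≤s z≤n)) (s≤s z≤n)))
digitsTest-reflects a (true ∷ c)  (true ∷ s)  = digitsTest-reflects (a + suc (a + 0) + 1) c s
digitsTest-reflects a (false ∷ c) (false ∷ s) = digitsTest-reflects (a + suc (a + 0) + 0) c s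
digitsTest-reflects a (true ∷ c)  (false ∷ s) with atLeast c s | atLeast-reflects c s
... | true  | ofʸ ≤c = ofʸ (<⇒≤ (valueFrom-<-lead s c (+-monoʳ-< (2 * suc a) (s≤s z≤n)) ≤c))
... | false | ofⁿ ≰c = ofⁿ (<⇒≱ (valueFrom-<-length c s (odd<twice-even a) (≰⇒> ≰c)))
digitsTest-reflects a (false ∷ c) (true ∷ s)
  with atLeast c (true ∷ s) | atLeast-reflects c (true ∷ s)
... | true  | ofʸ ≤c = ofʸ (<⇒≤ (valueFrom-<-length s c (odd<twice-even a) ≤c))
... | false | ofⁿ ≰c =
  ofⁿ (<⇒≱ (valueFrom-<-lead c s (+-monoʳ-< (2 * suc a) (s≤s z≤n)) (s≤s⁻¹ (≰⇒> ≰c))))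

test-leading : ∀ c s → test c s ≡ true → ∃[ p ] s ≡ true ∷ p
test-leading (false ∷ c) s          eq = test-leading c s eq
test-leading (true ∷ c)  (true ∷ p) eq = p , refl

valueFrom-≥1 : ∀ p → 1 ≤ valueFrom 1 p
valueFrom-≥1 p =
  ≤-trans (m^n>0 2 (length p)) (≤-trans (≤-reflexive (sym (*-identityˡ _))) (valueFrom-≥ 1 p))

test-reflects : ∀ c p → Reflects (valueFrom 1 p ≤ value c) (test c (true ∷ p))
test-reflects []          p = ofⁿ (<⇒≱ (valueFrom-≥1 p))
test-reflects (false ∷ c) p = test-reflects c p
test-reflects (true ∷ c)  p = digitsTest-reflects 0 c p

-- Fails at 0, whose expansion is empty; hence `suc n` here and a leading one in what follows.
binaryLSB-double : ∀ n → binaryLSB (2 * suc n + 0) ≡ false ∷ binaryLSB (suc n)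
binaryLSB-double zero    = refl
binaryLSB-double (suc n) =
  trans (cong binaryLSB (lem n)) (cong increment (cong increment (binaryLSB-double n)))
  where
  lem : ∀ n → 2 * suc (suc n) + 0 ≡ suc (suc (2 * suc n + 0))
  lem = solve-∀

binaryLSB-∷ : ∀ n b → binaryLSB (2 * suc n + bitValue b) ≡ b ∷ binaryLSB (suc n)
binaryLSB-∷ n false = binaryLSB-double n
binaryLSB-∷ n true  = trans (cong binaryLSB (+-suc (2 * suc n) 0)) (cong increment (binaryLSB-double n))

binaryLSB-valueFrom : ∀ n p → binaryLSB (valueFrom (suc n) p) ≡ p ʳ++ binaryLSB (suc n)
binaryLSB-valueFrom n []      = refl
binaryLSB-valueFrom n (b ∷ p) =
  trans (binaryLSB-valueFrom (n + suc (n + 0) + bitValue b) p) (cong (p ʳ++_) (binaryLSB-∷ n b))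

binary-valueFrom : ∀ p → binary (valueFrom 1 p) ≡ true ∷ p
binary-valueFrom p = begin
  List.reverse (binaryLSB (valueFrom 1 p))   ≡⟨ cong List.reverse (binaryLSB-valueFrom 0 p) ⟩
  (p ʳ++ true ∷ []) ʳ++ []                   ≡⟨ ʳ++-ʳ++ p ⟩
  true ∷ (p ++ [])                           ≡⟨ cong (true ∷_) (++-identityʳ p) ⟩
  true ∷ p                                   ∎
  where open ≡-Reasoning

valueFrom-ʳ++ : ∀ a r p → valueFrom a (r ʳ++ p) ≡ valueFrom (valueFrom a (r ʳ++ [])) p
valueFrom-ʳ++ a []      p = refl
valueFrom-ʳ++ a (b ∷ r) p = begin
  valueFrom a (r ʳ++ b ∷ p)                                              ≡⟨ valueFrom-ʳ++ a r (b ∷ p) ⟩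
  valueFrom (2 * valueFrom a (r ʳ++ []) + bitValue b) p
    ≡⟨ cong (λ k → valueFrom k p) (valueFrom-ʳ++ a r (b ∷ [])) ⟨
  valueFrom (valueFrom a (r ʳ++ b ∷ [])) p                               ∎
  where open ≡-Reasoning

-- Binary increment on the digits below the leading one, least significant first. A carry past all
-- of them adds a zero, as the leading one becomes 10.
valueFrom-suc : ∀ r → ∃[ r′ ] valueFrom 1 (r′ ʳ++ []) ≡ suc (valueFrom 1 (r ʳ++ []))
valueFrom-suc []          = false ∷ [] , refl
valueFrom-suc (false ∷ r) = true ∷ r , (begin
  valueFrom 1 (r ʳ++ true ∷ [])                 ≡⟨ valueFrom-ʳ++ 1 r (true ∷ []) ⟩
  2 * valueFrom 1 (r ʳ++ []) + 1                ≡⟨ +-suc _ 0 ⟩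
  suc (2 * valueFrom 1 (r ʳ++ []) + 0)          ≡⟨ cong suc (valueFrom-ʳ++ 1 r (false ∷ [])) ⟨
  suc (valueFrom 1 (r ʳ++ false ∷ []))          ∎)
  where open ≡-Reasoning
valueFrom-suc (true ∷ r)  = let r′ , eq = valueFrom-suc r in false ∷ r′ , (begin
  valueFrom 1 (r′ ʳ++ false ∷ [])               ≡⟨ valueFrom-ʳ++ 1 r′ (false ∷ []) ⟩
  2 * valueFrom 1 (r′ ʳ++ []) + 0               ≡⟨ cong (λ k → 2 * k + 0) eq ⟩
  2 * suc (valueFrom 1 (r ʳ++ [])) + 0          ≡⟨ lem (valueFrom 1 (r ʳ++ [])) ⟩
  suc (2 * valueFrom 1 (r ʳ++ []) + 1)          ≡⟨ cong suc (valueFrom-ʳ++ 1 r (true ∷ [])) ⟨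
  suc (valueFrom 1 (r ʳ++ true ∷ []))           ∎)
  where
  open ≡-Reasoning
  lem : ∀ n → 2 * suc n + 0 ≡ suc (2 * n + 1)
  lem = solve-∀

valueFrom-surjective : ∀ k → ∃[ p ] valueFrom 1 p ≡ suc k
valueFrom-surjective k = let r , eq = go k in r ʳ++ [] , eq
  where
  go : ∀ k → ∃[ r ] valueFrom 1 (r ʳ++ []) ≡ suc k
  go zero    = [] , refl
  go (suc k) = let r , eq = go k ; r′ , eq′ = valueFrom-suc r in r′ , trans eq′ (cong suc eq)

test-binary : ∀ c k → 1 ≤ k → Reflects (k ≤ value c) (test c (binary k))
test-binary c (suc k) _ with valueFrom-surjective k
... | p , eq = subst (λ k → Reflects (k ≤ value c) (test c (binary k))) eq
                 (subst (λ s → Reflects (valueFrom 1 p ≤ value c) (test c s))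
                   (sym (binary-valueFrom p)) (test-reflects c p))

-- Acceptance forces a leading one, and a word with a leading one is the expansion of its value.
-- This parses the last block.
test-sound : ∀ c s → test c s ≡ true → ∃[ k ] 1 ≤ k × s ≡ binary k
test-sound c s eq with test-leading c s eq
... | p , refl = valueFrom 1 p , valueFrom-≥1 p , sym (binary-valueFrom p)

pay-mono-length : ∀ c s t {n} → length s ≤ length t → pay c s n ≤ pay c t n
pay-mono-length c []      t       _  = ≤-pay c t
pay-mono-length c (_ ∷ s) (_ ∷ t) le = +-monoʳ-≤ c (pay-mono-length c s t (s≤s⁻¹ le))

inputStore : Word → Word → Vec Zipper 4
inputStore x y = ([] , x) ∷ ([] , y) ∷ ([] , []) ∷ ([] , []) ∷ []

-- `judgeCost` with final budget 0, for words instead of vectors.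
judgeBound : Word → Word → Word → ℕ
judgeBound x y s = loadCost x y (pay credit s (collectCost y (16 + pay 3 (false ∷ y) 21)))

verifyCost : Word → Word → Word → ℕ
verifyCost x y s = pay 5 x (6 + pay 5 y (6 + judgeBound x y s))

module _ {n m} (x : Vec Bool n) (y : Vec Bool m) where

  private
    xs = toList x
    ys = toList y

  judgeCost-bound : ∀ t s → length s ≤ length t → judgeCost x y s 0 ≤ judgeBound xs ys t
  judgeCost-bound t s le =
    pay-mono 5 ys (+-monoʳ-≤ 3 (pay-mono 5 xs (+-monoʳ-≤ 3 (pay-mono-length credit s t le))))

  sized-then : ∀ s₁ t {r σ} →
               Run (sized Y >>= afterY)
                   ((xs ʳ++ [] , []) ∷ ([] , ys) ∷ ([] , []) ∷ ([] , []) ∷ [] , s₁)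
                   (pay 5 ys (6 + judgeBound xs ys t)) r σ 0 →
               Run verify (inputStore xs ys , unary n ++ s₁) (verifyCost xs ys t) r σ 0
  sized-then s₁ t ρ =
    sized-match (Slots.input inX ([] , [])) [] xs (length-toList x) >>= surplus 1 ρ

  judge-then : ∀ s t {r σ} → length s ≤ length t →
               Run judge (sizedStore xs ys , s) (judgeCost x y s 0) r σ 0 →
               Run verify (inputStore xs ys , unary n ++ unary m ++ s) (verifyCost xs ys t) r σ 0
  judge-then s t le ρ = sized-then (unary m ++ s) t
    (sized-match (Slots.input inY ([] , [])) [] ys (length-toList y) >>=
      waste (≤-trans (judgeCost-bound t s le) (n≤1+n _)) ρ)

  verify-mismatch : ∀ {k} s → m ≢ k → ∃[ σ ]
    Run verify (inputStore xs ys , unary n ++ unary k ++ s)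
        (verifyCost xs ys (unary n ++ unary k ++ s)) (just true) σ 0
  verify-mismatch {k} s neq
    with sized-run (Slots.input (inY {xs ʳ++ [] , []} {[] , []}) ([] , [])) [] ys (unary k ++ s)
  ... | σ , ρ rewrite sizeTest-≢ ys k {s} (λ eq → neq (trans (sym (length-toList y)) eq)) =
    _ , sized-then (unary k ++ s) (unary n ++ unary k ++ s) (ρ >>= ret ⦃ z≤n ⦄)

  verify-decides : ∀ (C : Circuit (n + m) (suc m)) (V : Circuit (suc m) (n + m)) k k≥1 →
    let I = record { n = n ; m = m ; C = C ; V = V ; k = k ; k≥1 = k≥1 } in ∃₂ λ r σ →
    Run verify (inputStore xs ys , encode I) (verifyCost xs ys (encode I)) r σ 0 ×
    Decides (eval V (eval C (x Vec.++ y)) ≡ x Vec.++ y × k ≤ value (toList (eval C (x Vec.++ y)))) r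
  verify-decides C V k k≥1 with judge-run x y C V (binary k) 0
  ... | r , σ , ρ , d =
    r , σ , judge-then s (unary n ++ unary m ++ s)
      (≤-trans (length-++-≤ʳ s {unary m}) (length-++-≤ʳ (unary m ++ s) {unary n})) ρ ,
    decides d (test-binary (toList (eval C (x Vec.++ y))) k k≥1)
    where
    s = encodeCircuit C ++ encodeCircuit V ++ binary k
    decides : ∀ {P Q : Set} {b r} → Decides (P × b ≡ true) r → Reflects Q b → Decides (P × Q) r
    decides (accept (p , refl)) (ofʸ q) = accept (p , q)
    decides (reject f)          (ofʸ q) = reject λ (p , _) → f (p , refl)
    decides (reject f)          (ofⁿ ¬q) = reject λ (_ , q) → ¬q q

  -- All that acceptance of a single `y` reveals: if `y` has the wrong length, only the first header
  -- has been parsed.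
  Sound : Word → Set
  Sound s = ∃[ s₁ ] s ≡ unary n ++ s₁ ×
    (sizeTest ys s₁ ≡ just true ⊎
     ∃₂ λ C V → ∃₂ λ k k≥1 →
       s ≡ encode (record { n = n ; m = m ; C = C ; V = V ; k = k ; k≥1 = k≥1 }))

  verify-total : ∀ s → ∃₂ λ r σ → Run verify (inputStore xs ys , s) (verifyCost xs ys s) r σ 0 ×
                                  (r ≡ just true → Sound s)
  verify-total s
    with sizeTest xs s in eq
       | sized-run (Slots.input (inX {[] , ys} {[] , []}) ([] , [])) [] xs s
           {1 + pay 5 ys (6 + judgeBound xs ys s)}
  ... | nothing    | σ , ρ = _ , _ , (ρ >>= ret ⦃ z≤n ⦄) , λ()
  ... | just true  | σ , ρ = _ , _ , (ρ >>= ret ⦃ z≤n ⦄) , λ()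
  -- The run with an unknown final store is dropped, and `sized-then` uses `sized-match` instead.
  ... | just false | _ with sizeTest-unary xs eq
  ...   | s₁ , refl rewrite length-toList x
    with sizeTest ys s₁ in eq₁
       | sized-run (Slots.input (inY {xs ʳ++ [] , []} {[] , []}) ([] , [])) [] ys s₁
           {1 + judgeBound xs ys (unary n ++ s₁)}
  ...     | nothing    | σ , ρ = _ , _ , sized-then s₁ (unary n ++ s₁) (ρ >>= ret ⦃ z≤n ⦄) , λ()
  ...     | just true  | σ , ρ =
    _ , _ , sized-then s₁ (unary n ++ s₁) (ρ >>= ret ⦃ z≤n ⦄) , λ _ → s₁ , refl , inj₁ eq₁
  ...     | just false | _ with sizeTest-unary ys eq₁
  ...       | s₂ , refl rewrite length-toList y with judge-total x y s₂ {0}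
  ...         | inj₂ (_ , ρ) = _ , _ , judge-then s₂ (unary n ++ unary m ++ s₂)
      (≤-trans (length-++-≤ʳ s₂ {unary m}) (length-++-≤ʳ (unary m ++ s₂) {unary n})) ρ , λ()
  ...         | inj₁ (C , V , s₃ , refl) with judge-run x y C V s₃ 0
  ...           | r , σ , ρ , d = r , σ , judge-then s₂ (unary n ++ unary m ++ s₂)
      (≤-trans (length-++-≤ʳ s₂ {unary m}) (length-++-≤ʳ (unary m ++ s₂) {unary n})) ρ , sound d
    where
    sound : ∀ {P r} → Decides (P × test (toList (eval C (x Vec.++ y))) s₃ ≡ true) r → r ≡ just true →
            Sound (unary n ++ unary m ++ encodeCircuit C ++ encodeCircuit V ++ s₃)
    sound (accept (_ , t)) _ with test-sound (toList (eval C (x Vec.++ y))) s₃ t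
    ... | k , k≥1 , refl = _ , refl , inj₂ (C , V , k , k≥1 , refl)

-- Composition with the reduction

⇓-deterministic : ∀ {a} (T : TM a) → let open TM T in
                  ∀ {c t t′ d d′} → c ⇓[ t ] d → c ⇓[ t′ ] d′ → t ≡ t′ × d ≡ d′
⇓-deterministic T (TM.halt _)   (TM.halt _)    = refl , refl
⇓-deterministic T (TM.halt eq)  (TM.next eq′ _) with () ← trans (sym eq) eq′
⇓-deterministic T (TM.next eq _) (TM.halt eq′) with () ← trans (sym eq) eq′
⇓-deterministic T (TM.next eq ρ) (TM.next eq′ ρ′) with refl ← trans (sym eq) eq′
  with ⇓-deterministic T ρ ρ′
... | refl , refl = refl , refl

Outputs-unique : ∀ {a} (T : TM a) {ws u v} → Outputs T ws u → Outputs T ws v → u ≡ v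
Outputs-unique T (_ , _ , ρ , refl) (_ , _ , ρ′ , refl) with refl , refl ← ⇓-deterministic T ρ ρ′ = refl

module _ {E : Set} where

  extent : Tape (Symbol E) → ℕ
  extent t = length (Tape.before t) + length (Tape.after t)

  extent-act : ∀ α (t : Tape (Symbol E)) → extent (act α t) ≤ suc (extent t)
  extent-act (s , stay)  (tape ls _ rs)       = n≤1+n _
  extent-act (s , left)  (tape [] _ rs)       = ≤-refl
  extent-act (s , left)  (tape (l ∷ ls) _ rs) = ≤-trans (≤-reflexive (+-suc (length ls) (length rs))) (n≤1+n _)
  extent-act (s , right) (tape ls _ [])       = ≤-refl
  extent-act (s , right) (tape ls _ (r ∷ rs)) =
    s≤s (+-monoʳ-≤ (length ls) (n≤1+n _))

  length-leadingBits : (ss : List (Symbol E)) → length (leadingBits ss) ≤ length ss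
  length-leadingBits []             = z≤n
  length-leadingBits (blank ∷ ss)   = z≤n
  length-leadingBits (bit b ∷ ss)   = s≤s (length-leadingBits ss)
  length-leadingBits (extra x ∷ ss) = z≤n

  length-contents : (t : Tape (Symbol E)) → length (contents t) ≤ suc (extent t)
  length-contents (tape ls s rs) = ≤-trans (length-leadingBits (s ∷ rs)) (s≤s (m≤n+m _ (length ls)))

  contents-load : ∀ w → contents {E} (load (List.map bit w)) ≡ w
  contents-load []      = refl
  contents-load (b ∷ w) = cong (b ∷_) (leading w)
    where
    leading : ∀ w → leadingBits {E} (List.map bit w) ≡ w
    leading []      = refl
    leading (b ∷ w) = cong (b ∷_) (leading w)

  before-load : ∀ w → Tape.before {Symbol E} (load (List.map bit w)) ≡ []
  before-load []      = refl
  before-load (b ∷ w) = refl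

-- A step adds at most one cell to a tape, so the time also bounds the length of the output.
extent-⇓ : ∀ {a} (T : TM a) → let open TM T in ∀ {c t d} j → c ⇓[ t ] d →
           extent (lookup (proj₂ d) j) ≤ extent (lookup (proj₂ c) j) + t
extent-⇓ T j (TM.halt _) = m≤m+n _ 0
extent-⇓ T {c = q , ts} {suc t} {d} j (TM.next eq ρ) with TM.δ T q (Vec.map Tape.scan ts) | eq
... | just (q′ , αs) | refl = begin
  extent (lookup (proj₂ d) j)                                  ≤⟨ extent-⇓ T j ρ ⟩
  extent (lookup (Vec.zipWith act αs ts) j) + t
    ≡⟨ cong (λ u → extent u + t) (lookup-zipWith act j αs ts) ⟩
  extent (act (lookup αs j) (lookup ts j)) + t                 ≤⟨ +-monoˡ-≤ t (extent-act (lookup αs j) (lookup ts j)) ⟩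
  suc (extent (lookup ts j)) + t                               ≡⟨ +-suc _ t ⟨
  extent (lookup ts j) + suc t                                 ∎
  where open ≤-Reasoning

module Composite (T : TM 1) where

  private
    module T = TM T
    open Compilation T.Extra T.work

  accepted : Result → Bool
  accepted (just true) = true
  accepted _           = false

  State : Set
  State = T.State ⊎ Pos verify ⊎ Bool ⊎ ⊤

  pattern reducing q   = inj₁ q
  pattern verifying a  = inj₂ (inj₁ a)
  pattern answering b  = inj₂ (inj₂ (inj₁ b))
  pattern done         = inj₂ (inj₂ (inj₂ tt))

  reduce : Scans → Maybe (T.State × Vec (Γ × Move) (2 + T.work)) → State × Actions
  reduce gs nothing = verifying (enter verify) , idle gs
  reduce (_ ∷ x ∷ y ∷ o ∷ v ∷ k ∷ _ ∷ _) (just (q , α ∷ β ∷ αs)) =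
    reducing q , α ∷ (x , stay) ∷ (y , stay) ∷ (o , stay) ∷ (v , stay) ∷ (k , stay) ∷ β ∷ αs

  conclude : (Pos verify ⊎ Result) × Actions → State × Actions
  conclude (inj₁ a , αs) = verifying a , αs
  conclude (inj₂ r , αs) = answering (accepted r) , αs

  out : Fin (7 + T.work)
  out = suc (suc (suc zero))

  δ : State → Scans → Maybe (State × Actions)
  δ (reducing q)  gs@(w ∷ _ ∷ _ ∷ _ ∷ _ ∷ _ ∷ s ∷ r) = just (reduce gs (T.δ q (w ∷ s ∷ r)))
  δ (verifying a) gs = just (conclude (δP a gs))
  δ (answering b) gs = just (done , idle gs [ out ]≔ (bit b , stay))
  δ done          gs = nothing

  machine : TM 3
  machine = record
    { State       = State
    ; Extra       = T.Extra
    ; finiteState = finite-⊎ T.finiteState (finite-⊎ (finite-Pos verify) (finite-⊎ finite-Bool finite-⊤))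
    ; finiteExtra = T.finiteExtra
    ; work        = 3 + T.work
    ; start       = inj₁ T.start
    ; δ           = δ
    }

  private module N = TM machine

  -- The output tape of `T` is the source of `verify`, and its head stays where `T` leaves it, which
  -- is where `output` starts.
  embed : Tape Γ → Tape Γ → T.Config → N.Config
  embed x y (q , t ∷ s ∷ ts) = reducing q , t ∷ x ∷ y ∷ load [] ∷ load [] ∷ load [] ∷ s ∷ ts

  step-reducing : ∀ {x y c c′} → T.step c ≡ just c′ → N.step (embed x y c) ≡ just (embed x y c′)
  step-reducing {c = q , t ∷ s ∷ ts} eq
    with T.δ q (Tape.scan t ∷ Tape.scan s ∷ Vec.map Tape.scan ts) | eq
  ... | just (q′ , α ∷ β ∷ αs) | refl = refl

  startVerifying : Tape Γ → Tape Γ → T.Config → N.Config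
  startVerifying x y (q , t ∷ s ∷ ts) =
    verifying (enter verify) , t ∷ x ∷ y ∷ load [] ∷ load [] ∷ load [] ∷ s ∷ ts

  step-reduced : ∀ {x y c} → T.step c ≡ nothing → N.step (embed x y c) ≡ just (startVerifying x y c)
  step-reduced {x} {y} {c = q , t ∷ s ∷ ts} eq
    with T.δ q (Tape.scan t ∷ Tape.scan s ∷ Vec.map Tape.scan ts) | eq
  ... | nothing | refl =
    cong (λ us → just (verifying (enter verify) ,
                       t ∷ x ∷ y ∷ load [] ∷ load [] ∷ load [] ∷ s ∷ us)) (perform-idle ts)

  ⇓-reducing : ∀ {x y c t d t′ e} → c T.⇓[ t ] d → startVerifying x y d N.⇓[ t′ ] e →
               embed x y c N.⇓[ t + suc t′ ] e
  ⇓-reducing (T.halt eq)   ρ′ = N.next (step-reduced eq) ρ′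
  ⇓-reducing (T.next eq ρ) ρ′ = N.next (step-reducing eq) (⇓-reducing ρ ρ′)

  apply : Tapes → State × Actions → N.Config
  apply ts z = proj₁ z , perform (proj₂ z) ts

  ⇓-verifying : ∀ {a ts t r ts′ t′ e} → Exec a ts t r ts′ →
                (answering (accepted r) , ts′) N.⇓[ t′ ] e →
                (verifying a , ts) N.⇓[ t + t′ ] e
  ⇓-verifying {ts = ts} (exit eq) ρ = N.next (cong (λ z → just (apply ts (conclude z))) eq) ρ
  ⇓-verifying {ts = ts} (go eq e) ρ =
    N.next (cong (λ z → just (apply ts (conclude z))) eq) (⇓-verifying e ρ)

  ⇓-answering : ∀ {b ts} → lookup ts out ≡ load [] →
                ∃[ e ] (answering b , ts) N.⇓[ 1 ] e × N.output e ≡ b ∷ []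
  ⇓-answering {b} {ts} eq = _ , N.next refl (N.halt refl) , (begin
    contents (lookup (perform (idle (Vec.map Tape.scan ts) [ out ]≔ (bit b , stay)) ts) out)
      ≡⟨ cong (λ us → contents (lookup us out)) (perform-at out (bit b , stay) ts) ⟩
    contents (lookup (ts [ out ]≔ act (bit b , stay) (lookup ts out)) out)
      ≡⟨ cong contents (lookup∘update out ts _) ⟩
    contents (act (bit b , stay) (lookup ts out))
      ≡⟨ cong (λ t → contents (act (bit b , stay) t)) eq ⟩
    b ∷ [] ∎)
    where open ≡-Reasoning

  output-blank : ∀ {ts σ} → Realises ts σ → lookup ts out ≡ load []
  output-blank {_ ∷ _ ∷ _ ∷ _ ∷ _ ∷ _ ∷ _ ∷ _} (_ , _ , _ , _ , o , _) = o

  holds-load : ∀ w → load (List.map bit w) Holds ([] , w)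
  holds-load w = subst (λ ls → Behind ls []) (sym (before-load w)) ([] []) , contents-load w

  -- The 2 counts the switch from `T` to `verify` and the writing of the answer.
  outputs-verdict : ∀ {w x y s t d n r σ n′} → T.initial (w ∷ []) T.⇓[ t ] d → T.output d ≡ s →
                    Run verify (inputStore x y , s) n r σ n′ →
                    ∃₂ λ t′ e → N.initial (w ∷ x ∷ y ∷ []) N.⇓[ t′ ] e ×
                                N.output e ≡ accepted r ∷ [] × t′ ≤ t + (2 + n)
  outputs-verdict {x = x} {y} {t = t} {d = _ , _ ∷ _ ∷ _} {n} {n′ = n′} ρ eq run
    with Exec-Run run (holds-load x , holds-load y , ([] [] , refl) , ([] [] , refl) , refl , eq)
  ... | t₁ , _ , e , R , t₁≤ with ⇓-answering (output-blank R)
  ...   | _ , ρ₂ , eq′ = _ , _ , ⇓-reducing ρ (⇓-verifying e ρ₂) , eq′ ,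
    +-monoʳ-≤ t (s≤s (≤-trans (≤-reflexive (+-comm t₁ 1)) (s≤s (≤-trans (m≤m+n t₁ n′) t₁≤))))

-- Polynomials

⟦⟧-mono : ∀ p {m n} → m ≤ n → ⟦ p ⟧ m ≤ ⟦ p ⟧ n
⟦⟧-mono []      m≤n = z≤n
⟦⟧-mono (a ∷ p) m≤n = +-monoʳ-≤ a (*-mono-≤ m≤n (⟦⟧-mono p m≤n))

infixl 6 _⊕_

_⊕_ : Polynomial → Polynomial → Polynomial
[]      ⊕ q       = q
(a ∷ p) ⊕ []      = a ∷ p
(a ∷ p) ⊕ (b ∷ q) = a + b ∷ p ⊕ q

⟦⊕⟧ : ∀ p q n → ⟦ p ⊕ q ⟧ n ≡ ⟦ p ⟧ n + ⟦ q ⟧ n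
⟦⊕⟧ []      q       n = refl
⟦⊕⟧ (a ∷ p) []      n = sym (+-identityʳ _)
⟦⊕⟧ (a ∷ p) (b ∷ q) n =
  trans (cong (λ k → a + b + n * k) (⟦⊕⟧ p q n)) (lem a b n (⟦ p ⟧ n) (⟦ q ⟧ n))
  where
  lem : ∀ a b n p q → a + b + n * (p + q) ≡ (a + n * p) + (b + n * q)
  lem = solve-∀

⟦scale⟧ : ∀ c p n → ⟦ List.map (c *_) p ⟧ n ≡ c * ⟦ p ⟧ n
⟦scale⟧ c []      n = sym (*-zeroʳ c)
⟦scale⟧ c (a ∷ p) n = trans (cong (λ k → c * a + n * k) (⟦scale⟧ c p n)) (lem c a n (⟦ p ⟧ n))
  where
  lem : ∀ c a n p → c * a + n * (c * p) ≡ c * (a + n * p)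
  lem = solve-∀

-- Uniqueness

bits : ∀ k → Vec Bool k ↔ Fin (2 ^ k)
bits zero    = mk↔ₛ′ (λ _ → zero) (λ _ → []) (λ { zero → refl }) (λ { [] → refl })
bits (suc k) = ↔-sym *↔× ↔-∘ ((↔-sym 2↔Bool ×-↔ bits k) ↔-∘
  mk↔ₛ′ (λ v → Vec.head v , Vec.tail v) (λ (b , v) → b ∷ v) (λ _ → refl) (λ { (b ∷ v) → refl }))

-- Pigeonhole for z together with the values of f.
noInjection : ∀ {k} z (f : Vec Bool k → Vec Bool k) →
              (∀ {u v} → f u ≡ f v → u ≡ v) → ¬ (∀ u → f u ≢ z)
noInjection {k} z f inj avoids with pigeonhole (n<1+n (2 ^ k)) hit
  where
  hit : Fin (suc (2 ^ k)) → Fin (2 ^ k)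
  hit zero    = Inverse.to (bits k) z
  hit (suc i) = Inverse.to (bits k) (f (Inverse.from (bits k) i))
... | zero  , suc j , _   , eq = avoids _ (sym (Injection.injective (↔⇒↣ (bits k)) eq))
... | suc i , suc j , i<j , eq =
  Fin.<-irrefl (cong suc (Injection.injective (↔⇒↣ (↔-sym (bits k)))
    (inj (Injection.injective (↔⇒↣ (bits k)) eq)))) i<j

value-zeros : ∀ k → value (toList (Vec.replicate k false)) ≡ 0
value-zeros zero    = refl
value-zeros (suc k) = value-zeros k

majority-unique : ∀ {n m k} (C : Vec Bool (n + m) → Vec Bool (suc m))
                  (V : Vec Bool (suc m) → Vec Bool (n + m)) → 1 ≤ k →
                  let Wins = λ x → ∀ y → V (C (x Vec.++ y)) ≡ x Vec.++ y ×
                                         k ≤ value (toList (C (x Vec.++ y))) in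
                  ∀ x x′ → Wins x → Wins x′ → x ≡ x′
majority-unique {n} {m} C V k≥1 x x′ wins wins′ with Vec.≡-dec Bool._≟_ x x′
... | yes eq = eq
... | no neq =
  ⊥-elim (noInjection (Vec.replicate (suc m) false) (λ v → C (edge v)) injective avoids)
  where
  -- The first bit selects one of the two winners, so `C` after `edge` is a self-map of the words of
  -- length m + 1.
  edge : Vec Bool (suc m) → Vec Bool (n + m)
  edge (b ∷ y) = (if b then x else x′) Vec.++ y

  inverse : ∀ v → V (C (edge v)) ≡ edge v
  inverse (true ∷ y)  = proj₁ (wins y)
  inverse (false ∷ y) = proj₁ (wins′ y)

  edge-injective : ∀ {u v} → edge u ≡ edge v → u ≡ v
  edge-injective {true ∷ _}  {true ∷ _}  eq = cong (true ∷_) (++-injectiveʳ x x eq)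
  edge-injective {false ∷ _} {false ∷ _} eq = cong (false ∷_) (++-injectiveʳ x′ x′ eq)
  edge-injective {true ∷ _}  {false ∷ _} eq = contradiction (++-injectiveˡ x x′ eq) neq
  edge-injective {false ∷ _} {true ∷ _}  eq = contradiction (sym (++-injectiveˡ x′ x eq)) neq

  injective : ∀ {u v} → C (edge u) ≡ C (edge v) → u ≡ v
  injective {u} {v} eq = edge-injective (trans (sym (inverse u)) (trans (cong V eq) (inverse v)))

  positive : ∀ v → 1 ≤ value (toList (C (edge v)))
  positive (true ∷ y)  = ≤-trans k≥1 (proj₂ (wins y))
  positive (false ∷ y) = ≤-trans k≥1 (proj₂ (wins′ y))

  avoids : ∀ v → C (edge v) ≢ Vec.replicate (suc m) false
  avoids v eq = n≮0 (≤-trans (positive v) (≤-reflexive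
    (trans (cong (λ c → value (toList c)) eq) (value-zeros (suc m)))))

-- Closed form of the running time, and unary headers

pay-linear : ∀ c s n → pay c s n ≡ length s * c + n
pay-linear c []      n = refl
pay-linear c (_ ∷ s) n = trans (cong (c +_) (pay-linear c s n)) (sym (+-assoc c _ n))

-- Each bit of `x` and `y` costs 5 in `sized` and 5 in loading; for `y` there are 5 more for
-- rewinding, 5 for K and 3 for `strip`.
verifyCost-linear : ∀ x y s → verifyCost x y s ≡ 10 * length x + 23 * length y + 20 * length s + 72
verifyCost-linear x y s
  rewrite pay-linear 5 x (6 + pay 5 y (6 + judgeBound x y s))
        | pay-linear 5 y (6 + judgeBound x y s)
        | pay-linear 5 y (3 + pay 5 x (3 + pay credit s (collectCost y (16 + pay 3 (false ∷ y) 21))))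
        | pay-linear 5 x (3 + pay credit s (collectCost y (16 + pay 3 (false ∷ y) 21)))
        | pay-linear credit s (collectCost y (16 + pay 3 (false ∷ y) 21))
        | pay-linear 5 y (5 + pay 5 (false ∷ y) (4 + (16 + pay 3 (false ∷ y) 21)))
        | pay-linear 5 y (4 + (16 + pay 3 (false ∷ y) 21))
        | pay-linear 3 y 21 = lem (length x) (length y) (length s)
  where
  lem : ∀ a b l → a * 5 + (6 + (b * 5 + (6 + (b * 5 + (3 + (a * 5 + (3 + (l * 20 +
                  (b * 5 + (5 + (5 + (b * 5 + (4 + (16 + (3 + (b * 3 + 21)))))))))))))))) ≡
                  10 * a + 23 * b + 20 * l + 72
  lem = solve-∀

length-unary : ∀ n → length (unary n) ≡ suc n
length-unary zero    = refl
length-unary (suc n) = cong suc (length-unary n)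

≤-length-unary : ∀ n s → n ≤ length (unary n ++ s)
≤-length-unary zero    s = z≤n
≤-length-unary (suc n) s = s≤s (≤-length-unary n s)

unary-injective : ∀ m n {s t} → unary m ++ s ≡ unary n ++ t → m ≡ n
unary-injective zero    zero    eq = refl
unary-injective (suc m) (suc n) eq = cong suc (unary-injective m n (∷-injectiveʳ eq))

unary-prefix : ∀ s → (∃₂ λ n s′ → s ≡ unary n ++ s′) ⊎ (∃[ n ] s ≡ List.replicate n true)
unary-prefix []          = inj₂ (0 , refl)
unary-prefix (false ∷ s) = inj₁ (0 , s , refl)
unary-prefix (true ∷ s) with unary-prefix s
... | inj₁ (n , s′ , refl) = inj₁ (suc n , s′ , refl)
... | inj₂ (n , refl)      = inj₂ (suc n , refl)

sizeTest-match : ∀ z {k s} → length z ≡ k → sizeTest z (unary k ++ s) ≡ just false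
sizeTest-match []      refl = refl
sizeTest-match (_ ∷ z) refl = sizeTest-match z refl

sizeTest-truncated : ∀ z {k} → length z ≡ k → sizeTest z (List.replicate k true) ≡ nothing
sizeTest-truncated []      refl = refl
sizeTest-truncated (_ ∷ z) refl = sizeTest-truncated z refl

-- The machine for a given reduction and its winning words

module Verification {L : Language} (R : L ≤ₚ EdgeMajority) where

  open _≤ₚ_ R renaming (machine to T; polyTime to T-polyTime)

  P = proj₁ T-polyTime

  open Composite T using (accepted; outputs-verdict) renaming (machine to N)

  private
    module T = TM T
    module N = TM N

  reduction : ∀ w → ∃₂ λ t d → T.initial (w ∷ []) T.⇓[ t ] d × T.output d ≡ f w × t ≤ ⟦ P ⟧ (length w)
  reduction w with proj₂ T-polyTime (w ∷ []) | computes w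
  ... | t , d , ρ , t≤ | _ , _ , ρ′ , eq with ⇓-deterministic T ρ ρ′
  ...   | refl , refl = t , d , ρ , eq , subst (λ n → t ≤ ⟦ P ⟧ n) (+-identityʳ (length w)) t≤

  -- The output tape starts with extent 0; the additional cell is the scanned one.
  length-f : ∀ w → length (f w) ≤ suc (⟦ P ⟧ (length w))
  length-f w with reduction w
  ... | t , d , ρ , eq , t≤ = begin
    length (f w)                                        ≡⟨ cong length eq ⟨
    length (T.output d)                                 ≤⟨ length-contents (lookup (proj₂ d) (1 ↑ʳ zero)) ⟩
    suc (extent (lookup (proj₂ d) (1 ↑ʳ zero)))         ≤⟨ s≤s (extent-⇓ T (1 ↑ʳ zero) ρ) ⟩
    suc t                                               ≤⟨ s≤s t≤ ⟩
    suc (⟦ P ⟧ (length w))                              ∎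
    where open ≤-Reasoning

  answer : ∀ w x y {n r σ n′} → Run verify (inputStore x y , f w) n r σ n′ →
           Outputs N (w ∷ x ∷ y ∷ []) (accepted r ∷ [])
  answer w x y ρ with reduction w
  ... | t , d , ρ₀ , eq , _ with outputs-verdict ρ₀ eq ρ
  ...   | t′ , e , ρ′ , eq′ , _ = t′ , e , ρ′ , eq′

  -- The reduction contributes P and reading its output 20 (P + 1); 94 is 20 + 72 + 2, and 23 is the
  -- larger of the coefficients of |x| and |y|.
  timeBound : Polynomial
  timeBound = List.map (21 *_) P ⊕ (94 ∷ 23 ∷ [])

  verify-words : ∀ x y s → ∃₂ λ r σ → Run verify (inputStore x y , s) (verifyCost x y s) r σ 0
  verify-words x y s =
    let r , σ , ρ , _ = verify-total (Vec.fromList x) (Vec.fromList y) s in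
    r , σ , subst₂ (λ x y → Run verify (inputStore x y , s) (verifyCost x y s) r σ 0)
              (toList∘fromList x) (toList∘fromList y) ρ

  time-linear : ∀ p t w x y l → t ≤ p → l ≤ suc p →
                t + (2 + (10 * x + 23 * y + 20 * l + 72)) ≤
                21 * p + (94 + (w + (x + (y + 0))) * (23 + (w + (x + (y + 0))) * 0))
  time-linear p t w x y l t≤ l≤ = begin
    t + (2 + (10 * x + 23 * y + 20 * l + 72))
      ≤⟨ +-mono-≤ t≤ (+-monoʳ-≤ 2 (+-monoˡ-≤ 72 (+-monoʳ-≤ (10 * x + 23 * y) (*-monoʳ-≤ 20 l≤)))) ⟩
    -- Padding that brings all three lengths to the coefficient 23.
    p + (2 + (10 * x + 23 * y + 20 * suc p + 72))      ≤⟨ m≤m+n _ (23 * w + 13 * x) ⟩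
    p + (2 + (10 * x + 23 * y + 20 * suc p + 72)) + (23 * w + 13 * x)  ≡⟨ lem p w x y ⟩
    21 * p + (94 + (w + (x + (y + 0))) * (23 + (w + (x + (y + 0))) * 0)) ∎
    where
    open ≤-Reasoning
    lem : ∀ p w x y → p + (2 + (10 * x + 23 * y + 20 * suc p + 72)) + (23 * w + 13 * x) ≡
                      21 * p + (94 + (w + (x + (y + 0))) * (23 + (w + (x + (y + 0))) * 0))
    lem = solve-∀

  N-polyTime : PolyTime N
  N-polyTime = timeBound , bound
    where
    bound : ∀ ws → ∃₂ λ t d → N.initial ws N.⇓[ t ] d × t ≤ ⟦ timeBound ⟧ (Vec.sum (Vec.map length ws))
    bound (w ∷ x ∷ y ∷ []) with reduction w | verify-words x y (f w)
    ... | t , d , ρ₀ , eq , t≤ | r , σ , ρ with outputs-verdict ρ₀ eq ρ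
    ...   | t′ , e , ρ′ , _ , t′≤ = t′ , e , ρ′ , (begin
      t′                                                       ≤⟨ t′≤ ⟩
      t + (2 + verifyCost x y (f w))
        ≡⟨ cong (λ k → t + (2 + k)) (verifyCost-linear x y (f w)) ⟩
      t + (2 + (10 * length x + 23 * length y + 20 * length (f w) + 72))
        ≤⟨ time-linear (⟦ P ⟧ S) t (length w) (length x) (length y) (length (f w))
             (≤-trans t≤ P≤) (≤-trans (length-f w) (s≤s P≤)) ⟩
      21 * ⟦ P ⟧ S + ⟦ 94 ∷ 23 ∷ [] ⟧ S                        ≡⟨ cong (_+ ⟦ 94 ∷ 23 ∷ [] ⟧ S) (⟦scale⟧ 21 P S) ⟨
      ⟦ List.map (21 *_) P ⟧ S + ⟦ 94 ∷ 23 ∷ [] ⟧ S            ≡⟨ ⟦⊕⟧ (List.map (21 *_) P) (94 ∷ 23 ∷ []) S ⟨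
      ⟦ timeBound ⟧ S                                          ∎)
      where
      open ≤-Reasoning
      S = length w + (length x + (length y + 0))
      P≤ : ⟦ P ⟧ (length w) ≤ ⟦ P ⟧ S
      P≤ = ⟦⟧-mono P (m≤m+n (length w) _)

  -- Chosen so that every word no longer than `f w` is short, in particular `x` and each `y` of the
  -- right length.
  lengthBound : Polynomial
  lengthBound = (1 ∷ []) ⊕ P

  Short : Word → Word → Set
  Short w x = length x ≤ ⟦ lengthBound ⟧ (length w)

  Winning : Word → Word → Set
  Winning w x = ∀ y → Short w y → Outputs N (w ∷ x ∷ y ∷ []) (true ∷ [])

  short : ∀ w {x} → length x ≤ length (f w) → Short w x
  short w {x} x≤ = begin
    length x                              ≤⟨ x≤ ⟩
    length (f w)                          ≤⟨ length-f w ⟩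
    suc (⟦ P ⟧ (length w))                ≡⟨ cong (λ k → suc k + ⟦ P ⟧ (length w)) (*-zeroʳ (length w)) ⟨
    ⟦ 1 ∷ [] ⟧ (length w) + ⟦ P ⟧ (length w) ≡⟨ ⟦⊕⟧ (1 ∷ []) P (length w) ⟨
    ⟦ lengthBound ⟧ (length w)            ∎
    where open ≤-Reasoning

  accepted-true : ∀ r → accepted r ≡ true → r ≡ just true
  accepted-true (just true) _ = refl

  -- By determinism the given accepting computation and the one obtained from `Run` have the same
  -- output.
  wins : ∀ {w x y n r σ n′} → Outputs N (w ∷ x ∷ y ∷ []) (true ∷ []) →
         Run verify (inputStore x y , f w) n r σ n′ → r ≡ just true
  wins {w} {x} {y} out ρ =
    accepted-true _ (∷-injectiveˡ (Outputs-unique N {w ∷ x ∷ y ∷ []} (answer w x y ρ) out))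

  Certifies : (I : Instance) → let open Instance I in Vec Bool n → Set
  Certifies I x = ∀ y → eval V (eval C (x Vec.++ y)) ≡ x Vec.++ y ×
                        k ≤ value (toList (eval C (x Vec.++ y)))
    where open Instance I

  Decides-true : ∀ {Q r} → Decides Q r → r ≡ just true → Q
  Decides-true (accept q) _ = q

  n≤encode : ∀ I → Instance.n I ≤ length (encode I)
  n≤encode I = ≤-length-unary n _
    where open Instance I

  m≤encode : ∀ I → Instance.m I ≤ length (encode I)
  m≤encode I = ≤-trans (≤-length-unary m _) (length-++-≤ʳ _ {unary n})
    where open Instance I

  winning-certifies : ∀ {w} I x → f w ≡ encode I → Winning w (toList x) → Certifies I x
  winning-certifies {w} I x eq win y with verify-decides x y C V k k≥1
    where open Instance I
  ... | r , σ , ρ , d = Decides-true d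
    (wins (win (toList y) (short w {toList y}
            (subst₂ _≤_ (sym (length-toList y)) (cong length (sym eq)) (m≤encode I))))
          (subst (λ s → Run verify (inputStore (toList x) (toList y) , s)
                            (verifyCost (toList x) (toList y) (encode I)) r σ 0) (sym eq) ρ))

  certifies-winning : ∀ {w} I x → f w ≡ encode I → Certifies I x → Winning w (toList x)
  certifies-winning {w} I x eq cert y _ = by-length (length y ≟ m)
    where
    open Instance I

    wins-on : ∀ {m} (y′ : Vec Bool m) → toList y′ ≡ y → ∀ {σ} →
              Run verify (inputStore (toList x) (toList y′) , encode I)
                  (verifyCost (toList x) (toList y′) (encode I)) (just true) σ 0 →
              Outputs N (w ∷ toList x ∷ y ∷ []) (true ∷ [])
    wins-on y′ refl {σ} ρ = answer w (toList x) (toList y′)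
      (subst (λ s → Run verify (inputStore (toList x) (toList y′) , s)
                        (verifyCost (toList x) (toList y′) (encode I)) (just true) σ 0) (sym eq) ρ)

    by-length : Dec (length y ≡ m) → Outputs N (w ∷ toList x ∷ y ∷ []) (true ∷ [])
    by-length (no neq) =
      wins-on (Vec.fromList y) (toList∘fromList y) (proj₂ (verify-mismatch x (Vec.fromList y) _ neq))
    by-length (yes y≡m)
      with Vec.cast y≡m (Vec.fromList y) | trans (toList-cast y≡m (Vec.fromList y)) (toList∘fromList y)
    ... | y′ | eq′ with verify-decides x y′ C V k k≥1
    ...   | _ , _ , ρ , accept _ = wins-on y′ eq′ ρ
    ...   | _ , _ , _ , reject c = contradiction (cert y′) c

  winning-sound : ∀ {w n m} (x : Vec Bool n) (y : Vec Bool m) → Winning w (toList x) → m ≤ length (f w) →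
                  Sound x y (f w)
  winning-sound {w} x y win m≤ with verify-total x y (f w)
  ... | r , σ , ρ , sound =
    sound (wins (win (toList y) (short w {toList y}
      (subst (_≤ length (f w)) (sym (length-toList y)) m≤))) ρ)

  -- A winner accepts against every short word, so one may choose the `y` whose length rules out the
  -- escape by mismatch; acceptance then means that the whole of `f w` was parsed.
  winning-encodes : ∀ {w n} (x : Vec Bool n) → Winning w (toList x) →
                    ∃₂ λ m C → ∃₂ λ V k → ∃[ k≥1 ]
                    f w ≡ encode (record { n = n ; m = m ; C = C ; V = V ; k = k ; k≥1 = k≥1 })
  -- The empty word is short in any case and shows that `f w` starts with `unary n`.
  winning-encodes {w} {n} x win with winning-sound x [] win z≤n
  ... | s , eq , _ = encodes (unary-prefix s)
    where
    s≤ : length s ≤ length (f w)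
    s≤ = subst (λ t → length s ≤ length t) (sym eq) (length-++-≤ʳ s {unary n})

    attempt : ∀ m → m ≤ length s → sizeTest (toList (Vec.replicate m false)) s ≢ just true → _
    attempt m m≤ neq with winning-sound x (Vec.replicate m false) win (≤-trans m≤ s≤)
    ... | s′ , eq′ , inj₁ test with refl ← ++-cancelˡ (unary n) s s′ (trans (sym eq) eq′) =
      contradiction test neq
    ... | _ , _ , inj₂ (C , V , k , k≥1 , eq″) = m , C , V , k , k≥1 , eq″

    encodes : (∃₂ λ m s′ → s ≡ unary m ++ s′) ⊎ (∃[ m ] s ≡ List.replicate m true) → _
    encodes (inj₁ (m , s′ , refl)) =
      let z = Vec.replicate m false in attempt m (≤-length-unary m s′) λ test →
        contradiction (trans (sym test) (sizeTest-match (toList z) (length-toList z))) λ()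
    -- The second header has no end; on a word of the same length `sizeTest` gives `nothing`, which
    -- is no mismatch either.
    encodes (inj₂ (m , refl))      =
      let z = Vec.replicate m false in attempt m (≤-reflexive (sym (length-replicate m))) λ test →
        contradiction (trans (sym test) (sizeTest-truncated (toList z) (length-toList z))) λ()

  -- Winners could differ in length, but both lengths are read off the first header of `f w`. Then
  -- both certify the same instance.
  winning-unique : ∀ {w n n′} (x : Vec Bool n) (x′ : Vec Bool n′) →
                   Winning w (toList x) → Winning w (toList x′) → toList x ≡ toList x′
  winning-unique {w} {n} {n′} x x′ win win′ with winning-encodes x win | winning-encodes x′ win′
  ... | m , C , V , k , k≥1 , eq | _ , _ , _ , _ , _ , eq′
    with refl ← unary-injective n n′ (trans (sym eq) eq′) =
    cong toList (majority-unique (eval C) (eval V) k≥1 x x′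
      (winning-certifies I x eq win) (winning-certifies I x′ eq win′))
    where
    I : Instance
    I = record { n = n ; m = m ; C = C ; V = V ; k = k ; k≥1 = k≥1 }

  vectorised : ∀ {w} x → Winning w x → Winning w (toList (Vec.fromList x))
  vectorised {w} x = subst (Winning w) (sym (toList∘fromList x))

  uΣ₂P : UΣ₂P L
  uΣ₂P = record
    { M        = N
    ; polyTime = N-polyTime
    ; p        = lengthBound
    ; correct  = λ w → mk⇔ (to w) (from w)
    ; unique   = λ w x x′ _ _ win win′ →
        subst₂ _≡_ (toList∘fromList x) (toList∘fromList x′)
          (winning-unique (Vec.fromList x) (Vec.fromList x′) (vectorised x win) (vectorised x′ win′))
    }
    where
    to : ∀ w → L w → ∃[ x ] (Short w x × Winning w x)
    to w w∈L with Equivalence.to (correct w) w∈L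
    ... | I , eq , x , cert =
      toList x ,
      short w {toList x} (subst₂ _≤_ (sym (length-toList x)) (cong length (sym eq)) (n≤encode I)) ,
      certifies-winning I x eq cert

    from : ∀ w → ∃[ x ] (Short w x × Winning w x) → L w
    from w (x , _ , win) with winning-encodes (Vec.fromList x) (vectorised x win)
    ... | m , C , V , k , k≥1 , eq = Equivalence.from (correct w)
      (I , eq , Vec.fromList x , winning-certifies I (Vec.fromList x) eq (vectorised x win))
      where
      I : Instance
      I = record { n = length x ; m = m ; C = C ; V = V ; k = k ; k≥1 = k≥1 }

theorem5p2 : PMA ⊆ UΣ₂P
theorem5p2 R = Verification.uΣ₂P R
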